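{- Let $u\le w$ in $\mathbb{P}^*$ and order the maximal chains of $[u,w]$ lexicographically by label sequence. Then: (1) For each normal embedding $\eta_u$ of $u$ into $w$ there is a unique maximal chain of $[u,w]$ with weakly decreasing label sequence ending at $\eta_u$, and the map sending $\eta_u$ to this chain is a bijection from the set of normal embeddings of $u$ into $w$ onto the set of critical chains of $[u,w]$. (2) If $C$ is a critical chain ending at $\eta_u$, then $\mathcal{I}(C)=\mathcal{J}(C)$ and $\#\mathcal{I}(C)=d(\eta_u)+2D(\eta_u)-1$.
   Context: $\mathbb{P}^*$: finite words over the positive integers, $u\le w$ iff $w$ has a subword $w(i_1)\cdots w(i_l)$ ($i_1<\dots<i_l$, $l=|u|$) with $u(j)\le w(i_j)$. Covers: $y$ is obtained from $x$ by decreasing one entry by $1$ (deleting it if it becomes $0$). An expansion of $u$ is a word over nonnegative integers whose restriction to its nonzero positions is $u$; an embedding of $u$ into $w$ is an expansion $\eta_u$ of length $|w|$ with $\eta_u(i)\le w(i)$ for all $i$. A run of $k$'s in $w$ is a maximal index interval $[r,t]$ with $w(r)=\dots=w(t)=k$. An embedding $\eta_u$ is normal if $\eta_u(i)\in\{w(i),w(i)-1,0\}$ for all $i$, and for every run $[r,t]$ of $k$'s in $w$: if $k=1$ then $\eta_u(i)\ne0$ for $r<i\le t$; if $k\ge2$ then $\eta_u(r)\neq 0$. Defect: $d(\eta_u)=\#\{i:\eta_u(i)=w(i)-1\}$; also $D(\eta_u)=\#\{i:\eta_u(i)=0,\ w(i)\ge2\}$. Labels: for a maximal chain $C: w=v_0\gtrdot\cdots\gtrdot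 v_d=u$ set $\eta_{v_0}=w$; for $j\ge1$, $\eta_{v_j}$ is the expansion of $v_j$ obtained from $\eta_{v_{j-1}}$ by subtracting $1$ at a single position $i$, where, if that entry goes from $1$ to $0$, $i$ is the position of the leftmost $1$ of the run of $1$'s of $v_{j-1}$ containing the deleted entry; the label is $l_j=i$, $l(C)=(l_1,\dots,l_d)$, and $C$ ends at $\eta_{v_d}$ (an embedding of $u$ into $w$). $C$ is weakly decreasing if $l_1\ge l_2\ge\cdots\ge l_d$. Chains are ordered lexicographically by label sequence ($C'<C$ means $C'$ first). Intervals: for $0\le i<j\le d$, $j-i\ge 2$, $C(v_i,v_j)=\{v_{i+1},\dots,v_{j-1}\}$; it is skipped if $C\setminus C(v_i,v_j)\subseteq C'$ for some maximal chain $C'<C$; a minimal skipped interval (MSI) is a skipped interval strictly containing no other skipped interval. $\mathcal{I}(C)$ is the set of MSIs, listed $I_1,I_2,\dots$ in order of their first elements along $C$ (from $w$ downward). $\mathcal{J}(C)$ is built inductively: $J_1=I_1$; given $J_1,\dots,J_s$, replace each remaining $I_k$ by $I_k\setminus(J_1\cup\dots\cup J_s)$, discard empty sets and those strictly containing another of these modified sets, and let $J_{s+1}$ be the first remaining one in the order along $C$; stop when none remain. $C$ is critical if $\mathcal{J}(C)$ covers $C$, i.e. $\bigcup\mathcal{J}(C)=\{v_1,\dots,v_{d-1}\}$.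
   Formalization: Part (2) is stated for u ≠ w only: when u = w the single one-element chain is critical with no minimal skipped intervals and d = D = 0, so the formula would read 0 = −1. -}

module Defs where

open import Data.Nat using (ℕ; zero; suc; _+_; _*_; _∸_; _≤_; _<_; _≡ᵇ_; _≤ᵇ_)
open import Data.Bool using (Bool; true; false; _∧_; _∨_; not; if_then_else_)
open import Data.List using (List; []; _∷_; length; map; filterᵇ; null)
open import Data.List.Relation.Unary.All using (All)
open import Data.List.Relation.Unary.Any using (Any)
open import Data.List.Relation.Unary.Linked using (Linked)
open import Data.List.Membership.Propositional using (_∈_)
open import Data.Product using (Σ; ∃; _×_; _,_)
open import Data.Sum using (_⊎_)
open import Data.Empty using (⊥)
open import Data.Fin using (Fin; toℕ)
open import Relation.Nullary using (¬_)
open import Relation.Binary.PropositionalEquality using (_≡_; _≢_)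
open import Function.Bundles using (_⇔_)

-- Words.  A word of ℙ* is a list of naturals all of which are ≥ 1.
-- (Expansions / embeddings are lists of naturals, zeros allowed.)
-- Positions are 0-based (the paper uses 1-based positions; this
-- shift does not affect any order comparison of labels).

Word : Set
Word = List ℕ

Pos : Word → Set
Pos w = All (λ a → 1 ≤ a) w

-- entry at position i (0 outside the word; only used for i < length)
_!_ : List ℕ → ℕ → ℕ
[]      ! i       = 0
(a ∷ x) ! zero    = a
(a ∷ x) ! (suc i) = x ! i

data _≼_ : Word → Word → Set where
  nil  : ∀ {w} → [] ≼ w
  skip : ∀ {u w a} → u ≼ w → u ≼ (a ∷ w)
  take : ∀ {u w a b} → b ≤ a → u ≼ w → (b ∷ u) ≼ (a ∷ w)

decr : Word → ℕ → Word
decr []                  i       = []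
decr (zero ∷ x)          zero    = x
decr (suc zero ∷ x)      zero    = x
decr (suc (suc a) ∷ x)   zero    = suc a ∷ x
decr (a ∷ x)             (suc i) = a ∷ decr x i

Covers : Word → Word → Set
Covers x y = Σ ℕ λ i → i < length x × y ≡ decr x i

data ChainTo (u : Word) : Word → List Word → Set where
  single : ChainTo u u (u ∷ [])
  cons   : ∀ {x y ys} → Covers x y → ChainTo u y ys → ChainTo u x (x ∷ ys)

MaxChain : Word → Word → List Word → Set
MaxChain u w C = ChainTo u w C

len : List Word → ℕ
len C = length C ∸ 1

nz : List ℕ → Word
nz []           = []
nz (zero ∷ x)   = nz x
nz (suc a ∷ x)  = suc a ∷ nz x

sub1 : List ℕ → ℕ → List ℕ
sub1 []      i       = []
sub1 (a ∷ x) zero    = (a ∸ 1) ∷ x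
sub1 (a ∷ x) (suc i) = a ∷ sub1 x i

-- One labelled step: from the expansion η of v_{j-1} to the expansion
-- η' of v_j by subtracting 1 at position i (the label).  If the entry
-- goes from 1 to 0, i must be the leftmost 1 of its run of 1's in
-- v_{j-1}, i.e. the nearest nonzero entry of η to the left of i is
-- not a 1.
Step : List ℕ → Word → ℕ → List ℕ → Set
Step η y i η' =
  i < length η × 1 ≤ η ! i × η' ≡ sub1 η i × nz η' ≡ y ×
  (η ! i ≡ 1 →
    ¬ (Σ ℕ λ j → j < i × η ! j ≡ 1 × (∀ k → j < k → k < i → η ! k ≡ 0)))

data Labels : List ℕ → List Word → List ℕ → List ℕ → Set where
  done : ∀ {η} → Labels η [] [] η
  step : ∀ {η y ys i η' ls ηₑ} →
         Step η y i η' → Labels η' ys ls ηₑ → Labels η (y ∷ ys) (i ∷ ls) ηₑ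

Labeling : List Word → List ℕ → List ℕ → Set
Labeling []       ls η = ⊥
Labeling (w ∷ vs) ls η = Labels w vs ls η

WeaklyDecreasing : List ℕ → Set
WeaklyDecreasing ls = Linked (λ a b → b ≤ a) ls

data _<lex_ : List ℕ → List ℕ → Set where
  halt : ∀ {y ys} → [] <lex (y ∷ ys)
  this : ∀ {x y xs ys} → x < y → (x ∷ xs) <lex (y ∷ ys)
  next : ∀ {x xs ys} → xs <lex ys → (x ∷ xs) <lex (x ∷ ys)

_<ch_ : List Word → List Word → Set
C' <ch C = Σ (List ℕ) λ ls' → Σ (List ℕ) λ ls →
  Σ (List ℕ) λ η' → Σ (List ℕ) λ η →
  Labeling C' ls' η' × Labeling C ls η × ls' <lex ls

WDChain : Word → Word → List Word → List ℕ → Set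
WDChain u w C η = MaxChain u w C ×
  Σ (List ℕ) λ ls → Labeling C ls η × WeaklyDecreasing ls

-- Skipped intervals.  The interval C(v_i,v_j) = {v_{i+1},…,v_{j-1}}
-- (0 ≤ i < j ≤ d, j - i ≥ 2) is recorded by the index pair (i , j).

Skipped : Word → Word → List Word → ℕ → ℕ → Set
Skipped u w C i j =
  2 + i ≤ j × j ≤ len C ×
  Σ (List Word) λ C' → MaxChain u w C' × C' <ch C ×
    (∀ (k : Fin (length C)) → (toℕ k ≤ i ⊎ j ≤ toℕ k) →
       Data.List.lookup C k ∈ C')

-- C(v_k,v_l) ⊆ C(v_i,v_j) iff i ≤ k and l ≤ j (chain elements are
-- distinct), so a minimal skipped interval is:
MSI : Word → Word → List Word → ℕ → ℕ → Set
MSI u w C i j = Skipped u w C i j ×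
  (∀ k l → Skipped u w C k l → i ≤ k → l ≤ j → k ≡ i × l ≡ j)

MSIList : Word → Word → List Word → List (ℕ × ℕ) → Set
MSIList u w C Is =
  (∀ i j → (i , j) ∈ Is → MSI u w C i j) ×
  (∀ i j → MSI u w C i j → (i , j) ∈ Is) ×
  Linked (λ p q → Data.Product.proj₁ p < Data.Product.proj₁ q) Is

-- The collection 𝓙(C).  Sets of chain elements are represented by
-- lists of their indices along C.

interval : ℕ × ℕ → List ℕ
interval (i , j) = go (suc i) (j ∸ suc i)
  where
  go : ℕ → ℕ → List ℕ
  go a zero    = []
  go a (suc n) = a ∷ go (suc a) n

memb : ℕ → List ℕ → Bool
memb k []      = false
memb k (a ∷ A) = (k ≡ᵇ a) ∨ memb k A

subsetB : List ℕ → List ℕ → Bool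
subsetB []      B = true
subsetB (a ∷ A) B = memb a B ∧ subsetB A B

strictSupB : List ℕ → List ℕ → Bool
strictSupB A B = subsetB B A ∧ not (subsetB A B)

anyB : {X : Set} → (X → Bool) → List X → Bool
anyB p []      = false
anyB p (x ∷ xs) = p x ∨ anyB p xs

minus : List ℕ → List ℕ → List ℕ
minus A J = filterᵇ (λ k → not (memb k J)) A

prune : List (List ℕ) → List (List ℕ)
prune L = filterᵇ (λ A → not (anyB (strictSupB A) L')) L'
  where
  L' : List (List ℕ)
  L' = filterᵇ (λ A → not (null A)) L

-- J₁ = first set; the remaining sets are replaced by their difference
-- with J₁ (hence, iteratively, with J₁ ∪ … ∪ J_s) and pruned; repeat.
-- (fuel = number of sets, which suffices)
jseqF : ℕ → List (List ℕ) → List (List ℕ)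
jseqF zero    L       = []
jseqF (suc n) []      = []
jseqF (suc n) (J ∷ L) = J ∷ jseqF n (prune (map (λ A → minus A J) L))

𝓙 : List (ℕ × ℕ) → List (List ℕ)
𝓙 Is = jseqF (length Is) (map interval Is)

CoversChain : List Word → List (List ℕ) → Set
CoversChain C Js = ∀ k → (1 ≤ k × k < len C) ⇔ Any (λ J → k ∈ J) Js

Critical : Word → Word → List Word → Set
Critical u w C = Σ (List (ℕ × ℕ)) λ Is → MSIList u w C Is × CoversChain C (𝓙 Is)

SameSet : List ℕ → List ℕ → Set
SameSet A B = ∀ k → (k ∈ A) ⇔ (k ∈ B)

SameCollection : List (List ℕ) → List (List ℕ) → Set
SameCollection X Y = (All (λ A → Any (SameSet A) Y) X) × (All (λ B → Any (SameSet B) X) Y)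

NormalEmb : Word → Word → List ℕ → Set
NormalEmb u w η =
  length η ≡ length w × nz η ≡ u ×
  (∀ i → i < length w → η ! i ≤ w ! i) ×
  (∀ i → i < length w → η ! i ≡ w ! i ⊎ suc (η ! i) ≡ w ! i ⊎ η ! i ≡ 0) ×
  -- runs of 1's [r,t]: η(i) ≠ 0 for r < i ≤ t
  (∀ i → suc i < length w → w ! i ≡ 1 → w ! suc i ≡ 1 → η ! suc i ≢ 0) ×
  -- runs of k's, k ≥ 2, [r,t]: η(r) ≠ 0
  (∀ i → i < length w → 2 ≤ w ! i →
     (i ≡ 0 ⊎ Σ ℕ λ i' → i ≡ suc i' × w ! i' ≢ w ! i) → η ! i ≢ 0)

defect : List ℕ → Word → ℕ
defect (e ∷ η) (a ∷ w) = (if suc e ≡ᵇ a then 1 else 0) + defect η w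
defect _       _       = 0

Defect0 : List ℕ → Word → ℕ
Defect0 (e ∷ η) (a ∷ w) = (if (e ≡ᵇ 0) ∧ (2 ≤ᵇ a) then 1 else 0) + Defect0 η w
Defect0 _       _       = 0

-- A maximal chain from w is determined by its labels, so everything is read
-- off a label sequence l and the states f k p (entry p at time k).  Call an
-- interval of times basic if it is a descent of two consecutive labels, or a
-- constant block of labels erasing an entry a ≥ 2 whose nearest nonzero left
-- neighbour is also a.  Basic intervals are skipped: take the smaller of the two
-- labels first, or erase the left neighbour instead.  Conversely every skipped
-- interval contains a basic one: if the labels ascend and no block is basic, the
-- lower word sits rightmost greedily in the upper one, so no chain through both
-- can deviate to a smaller label.  Two basic intervals with a common interior
-- point coincide, hence the minimal skipped intervals are exactly the basic ones,
-- they are disjoint, and 𝓙(C) = 𝓘(C).  The basic intervals cover the chain iff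
-- the labels decrease weakly and the final embedding is normal.  In that case
-- they tile the chain, and each tile, like the last label, lowers the sum over p of
-- min(2 , f k p ∸ η p) by one.
module Submission where

open import Defs
open import Data.Bool using (Bool; true; false; _∧_; not; if_then_else_)
open import Data.Bool.Properties using (T-≡)
open import Data.Empty using (⊥; ⊥-elim)
open import Data.Fin using (Fin; zero; suc; toℕ; fromℕ<)
open import Data.Fin.Properties using (toℕ-fromℕ<; toℕ<n)
open import Data.List using (List; []; _∷_; _++_; filterᵇ; foldl; length; lookup; map; null; replicate)
open import Data.List.Membership.Propositional using (_∈_; find; lose)
open import Data.List.Properties using (length-map; map-id-local; ∷-injectiveˡ; ∷-injectiveʳ)
open import Data.List.Relation.Unary.All as All using (All; []; _∷_)
import Data.List.Relation.Unary.All.Properties as All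
open import Data.List.Relation.Unary.AllPairs using (AllPairs; []; _∷_)
import Data.List.Relation.Unary.AllPairs.Properties as AllPairs
open import Data.List.Relation.Unary.Any using (Any; here; there)
import Data.List.Relation.Unary.Any.Properties as Any
open import Data.List.Relation.Unary.Linked using (Linked; []; [-]; _∷_)
open import Data.List.Relation.Unary.Linked.Properties using (Linked⇒AllPairs; AllPairs⇒Linked)
open import Data.Nat
open import Data.Nat.ListAction using (sum)
open import Data.Nat.Properties
open import Data.Nat.Tactic.RingSolver using (solve-∀)
open import Data.Product using (Σ; _×_; _,_; map₂; proj₁; proj₂)
open import Data.Sum using (_⊎_; inj₁; inj₂; [_,_]′)
open import Data.Unit using (⊤; tt)
open import Function using (Equivalence; _∘_; flip; id; mk⇔)
open import Relation.Binary.Definitions using (tri<; tri≈; tri>)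
open import Relation.Binary.PropositionalEquality
  using (_≡_; _≢_; cong; cong₂; refl; subst; subst₂; sym; trans)
open import Relation.Nullary using (¬_; Dec; contradiction; no; yes)

-- Entry functions: greediness and truncated differences.

-- This is the situation that `Step` forbids when a 1 is erased at `i`: the nearest nonzero entry on
-- the left is also a 1.
LeftOne : (ℕ → ℕ) → ℕ → Set
LeftOne g i = Σ ℕ λ j → j < i × g j ≡ 1 × (∀ k → j < k → k < i → g k ≡ 0)

-- A violation of rightmost greediness: e sends nothing to p although the
-- letter it sends to the nearest occupied position on the left would fit there.
Violation : (ℕ → ℕ) → (ℕ → ℕ) → Set
Violation e x = Σ ℕ λ p' → Σ ℕ λ p → p' < p × 1 ≤ e p' ×
  (∀ k → p' < k → k < p → e k ≡ 0) × e p ≡ 0 × e p' ≤ x p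

cost : ℕ → (ℕ → ℕ) → (ℕ → ℕ) → ℕ
cost zero    g h = 0
cost (suc n) g h = (g 0 ∸ h 0) ⊓ 2 + cost n (g ∘ suc) (h ∘ suc)

cost-refl : ∀ n h → cost n h h ≡ 0
cost-refl zero h = refl
cost-refl (suc n) h rewrite n∸n≡0 (h 0) = cost-refl n (h ∘ suc)

cost-cong : ∀ n {g g' h : ℕ → ℕ} → (∀ q → g q ≡ g' q) → cost n g h ≡ cost n g' h
cost-cong zero eq = refl
cost-cong (suc n) {h = h} eq =
  cong₂ (λ x y → (x ∸ h 0) ⊓ 2 + y) (eq 0) (cost-cong n (λ q → eq (suc q)))

cost-step : ∀ n {g g' h : ℕ → ℕ} {p} → p < n → (∀ q → q ≢ p → g q ≡ g' q) →
  (g p ∸ h p) ⊓ 2 ≡ suc ((g' p ∸ h p) ⊓ 2) → cost n g h ≡ suc (cost n g' h)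
cost-step (suc n) {p = zero} _ same change = cong₂ _+_ change (cost-cong n (λ q → same (suc q) λ ()))
cost-step (suc n) {g} {g'} {h} {suc p} (s≤s p<n) same change
  rewrite same 0 (λ ()) =
  trans (cong ((g' 0 ∸ h 0) ⊓ 2 +_)
          (cost-step n p<n (λ q q≢p → same (suc q) (q≢p ∘ suc-injective)) change))
        (+-suc _ _)

-- Sequences of entry functions, one entry lowered by one at each step.

-- f k p is the entry at position p at time k.
module Walk (f : ℕ → ℕ → ℕ) (l : ℕ → ℕ) (d : ℕ)
  (drops : ∀ k → k < d → f k (l k) ≡ suc (f (suc k) (l k)))
  (keeps : ∀ k → k < d → ∀ q → q ≢ l k → f (suc k) q ≡ f k q) where

  fixed′ : ∀ q {s t} → s ≤′ t → t ≤ d → (∀ k → s ≤ k → k < t → l k ≢ q) → f t q ≡ f s q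
  fixed′ q ≤′-refl t≤d other = refl
  fixed′ q (≤′-step {n} s≤n) n<d other =
    trans (keeps n n<d q (λ eq → other n (≤′⇒≤ s≤n) ≤-refl (sym eq)))
          (fixed′ q s≤n (<⇒≤ n<d) (λ k s≤k k<n → other k s≤k (m<n⇒m<1+n k<n)))

  fixed : ∀ q {s t} → s ≤ t → t ≤ d → (∀ k → s ≤ k → k < t → l k ≢ q) → f t q ≡ f s q
  fixed q s≤t = fixed′ q (≤⇒≤′ s≤t)

  step≤ : ∀ k → k < d → ∀ q → f (suc k) q ≤ f k q
  step≤ k k<d q with q ≟ l k
  ... | yes refl = subst (f (suc k) q ≤_) (sym (drops k k<d)) (n≤1+n _)
  ... | no q≢ = ≤-reflexive (keeps k k<d q q≢)

  antitone′ : ∀ q {s t} → s ≤′ t → t ≤ d → f t q ≤ f s q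
  antitone′ q ≤′-refl t≤d = ≤-refl
  antitone′ q (≤′-step {n} s≤n) n<d = ≤-trans (step≤ n n<d q) (antitone′ q s≤n (<⇒≤ n<d))

  antitone : ∀ q {s t} → s ≤ t → t ≤ d → f t q ≤ f s q
  antitone q s≤t = antitone′ q (≤⇒≤′ s≤t)

  drops< : ∀ {s t} → s < t → t ≤ d → f t (l s) < f s (l s)
  drops< {s} s<t t≤d = subst (suc (f _ (l s)) ≤_) (sym (drops s (≤-trans s<t t≤d)))
    (s≤s (antitone (l s) s<t t≤d))

  -- A discrete intermediate value argument: entries fall by one at a time, so some step at `q`
  -- leaves from exactly `c`.
  crossing′ : ∀ q c {s t} → s ≤′ t → t ≤ d → c ≤ f s q → f t q < c →
    Σ ℕ λ k → s ≤ k × k < t × l k ≡ q × f k q ≡ c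
  crossing′ q c ≤′-refl t≤d c≤ <c = contradiction c≤ (<⇒≱ <c)
  crossing′ q c (≤′-step {n} s≤n) n<d c≤ <c with f n q <? c
  ... | yes fn<c with crossing′ q c s≤n (<⇒≤ n<d) c≤ fn<c
  ...   | k , s≤k , k<n , rest = k , s≤k , m<n⇒m<1+n k<n , rest
  crossing′ q c (≤′-step {n} s≤n) n<d c≤ <c | no fn≮c with q ≟ l n
  ... | yes refl = n , ≤′⇒≤ s≤n , ≤-refl , refl ,
    ≤-antisym (subst (_≤ c) (sym (drops n n<d)) <c) (≮⇒≥ fn≮c)
  ... | no q≢ = contradiction (subst (_< c) (keeps n n<d q q≢) <c) fn≮c

  crossing : ∀ q c {s t} → s ≤ t → t ≤ d → c ≤ f s q → f t q < c →
    Σ ℕ λ k → s ≤ k × k < t × l k ≡ q × f k q ≡ c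
  crossing q c s≤t = crossing′ q c (≤⇒≤′ s≤t)

  -- Value plus time is invariant while every label is `q`.
  constant-drop′ : ∀ q {s t} → s ≤′ t → t ≤ d → (∀ k → s ≤ k → k < t → l k ≡ q) →
    f s q + s ≡ f t q + t
  constant-drop′ q ≤′-refl t≤d all = refl
  constant-drop′ q {s} (≤′-step {n} s≤n) n<d all
    rewrite constant-drop′ q s≤n (<⇒≤ n<d) (λ k s≤k k<n → all k s≤k (m<n⇒m<1+n k<n))
    with refl ← all n (≤′⇒≤ s≤n) ≤-refl =
    trans (cong (_+ n) (drops n n<d)) (sym (+-suc _ n))

  constant-drop : ∀ q {s t} → s ≤ t → t ≤ d → (∀ k → s ≤ k → k < t → l k ≡ q) →
    f s q + s ≡ f t q + t
  constant-drop q s≤t = constant-drop′ q (≤⇒≤′ s≤t)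

  -- Basic intervals and their overlaps.

  -- By level and start, the entries at p' and p both equal j − i.
  record Flat (i j p p' : ℕ) : Set where
    field
      long    : 2 + i ≤ j
      inside  : j ≤ d
      labels  : ∀ k → i ≤ k → k < j → l k ≡ p
      emptied : f j p ≡ 0
      left    : p' < p
      gap     : ∀ k → p' < k → k < p → f i k ≡ 0
      level   : f i p' + i ≡ j

    start : f i p + i ≡ j
    start = trans (constant-drop p (≤-trans (m≤n+m i 2) long) inside labels) (cong (_+ j) emptied)

    unchanged : ∀ q → q ≢ p → ∀ {k} → i ≤ k → k ≤ j → f k q ≡ f i q
    unchanged q q≢p i≤k k≤j = fixed q i≤k (≤-trans k≤j inside)
      (λ m i≤m m<k lm≡q → q≢p (trans (sym lm≡q) (labels m i≤m (≤-trans m<k k≤j))))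

    remaining : ∀ {k} → i ≤ k → k ≤ j → f k p + k ≡ j
    remaining {k} i≤k k≤j = trans (constant-drop p k≤j inside
      (λ m k≤m → labels m (≤-trans i≤k k≤m))) (cong (_+ j) emptied)

  Descent : ℕ → ℕ → Set
  Descent i j = j ≡ 2 + i × j ≤ d × l (suc i) < l i

  Basic : ℕ → ℕ → Set
  Basic i j = Descent i j ⊎ Σ ℕ λ p → Σ ℕ λ p' → Flat i j p p'

  basic-long : ∀ {i j} → Basic i j → 2 + i ≤ j
  basic-long (inj₁ (refl , _)) = ≤-refl
  basic-long (inj₂ (_ , _ , F)) = Flat.long F

  basic-inside : ∀ {i j} → Basic i j → j ≤ d
  basic-inside (inj₁ (_ , j≤d , _)) = j≤d
  basic-inside (inj₂ (_ , _ , F)) = Flat.inside F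

  private
    left-unique : ∀ {g : ℕ → ℕ} {p p₁ p₂} → p₁ < p → p₂ < p → 1 ≤ g p₁ → 1 ≤ g p₂ →
      (∀ k → p₁ < k → k < p → g k ≡ 0) → (∀ k → p₂ < k → k < p → g k ≡ 0) → p₁ ≡ p₂
    left-unique {g} {p} {p₁} {p₂} <₁ <₂ 1≤₁ 1≤₂ gap₁ gap₂ with <-cmp p₁ p₂
    ... | tri≈ _ eq _ = eq
    ... | tri< lt _ _ = contradiction (subst (1 ≤_) (gap₁ p₂ lt <₂) 1≤₂) λ ()
    ... | tri> _ _ gt = contradiction (subst (1 ≤_) (gap₂ p₁ gt <₁) 1≤₁) λ ()

    suc-inside : ∀ {i k} → i < k → k < 2 + i → k ≡ suc i
    suc-inside i<k (s≤s k≤) = ≤-antisym k≤ i<k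

    -- A common interior time puts both labels of the descent inside the block, where labels are
    -- constant.
    descent-flat : ∀ {i j i₂ j₂ k p p'} → Descent i j → Flat i₂ j₂ p p' →
      i < k → k < j → i₂ < k → k < j₂ → ⊥
    descent-flat {i} (refl , _ , desc) F i<k k<j i₂<k k<j₂
      with refl ← suc-inside i<k k<j =
      <-irrefl (trans (Flat.labels F (suc i) (<⇒≤ i₂<k) k<j₂)
        (sym (Flat.labels F i (s≤s⁻¹ i₂<k) (<-trans (n<1+n i) k<j₂)))) desc

  level-positive : ∀ {i j p p'} → Flat i j p p' → 2 ≤ f i p'
  level-positive {i} F = +-cancelʳ-≤ i 2 _
    (subst (2 + i ≤_) (sym (Flat.level F)) (Flat.long F))

  -- Everything is recovered from the state at the common time `k`: the label gives `p`, the value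
  -- left at `p` gives the end `j`, the nearest nonzero position on the left gives `p'`, and the
  -- value there gives the start `i`.
  flat-overlap : ∀ {i j p p' i₂ j₂ p₂ p₂' k} → Flat i j p p' → Flat i₂ j₂ p₂ p₂' →
    i < k → k < j → i₂ < k → k < j₂ → i ≡ i₂ × j ≡ j₂
  flat-overlap {i} {j} {p} {p'} {i₂} {j₂} {_} {p₂'} {k} F G i<k k<j i₂<k k<j₂
    with refl ← trans (sym (Flat.labels F k (<⇒≤ i<k) k<j)) (Flat.labels G k (<⇒≤ i₂<k) k<j₂)
    with refl ← trans (sym (Flat.remaining F (<⇒≤ i<k) (<⇒≤ k<j)))
                      (Flat.remaining G (<⇒≤ i₂<k) (<⇒≤ k<j₂))
    with at ← (λ q (q<p : q < p) → Flat.unchanged F q (<⇒≢ q<p) (<⇒≤ i<k) (<⇒≤ k<j))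
    with at₂ ← (λ q (q<p : q < p) → Flat.unchanged G q (<⇒≢ q<p) (<⇒≤ i₂<k) (<⇒≤ k<j₂))
    with refl ← left-unique {f k} (Flat.left F) (Flat.left G)
      (subst (1 ≤_) (sym (at p' (Flat.left F))) (<⇒≤ (level-positive F)))
      (subst (1 ≤_) (sym (at₂ p₂' (Flat.left G))) (<⇒≤ (level-positive G)))
      (λ q a b → trans (at q b) (Flat.gap F q a b))
      (λ q a b → trans (at₂ q b) (Flat.gap G q a b)) =
    +-cancelˡ-≡ (f i p') i i₂ (trans (Flat.level F) (trans (sym (Flat.level G))
      (cong (_+ i₂) (trans (sym (at₂ p' (Flat.left G))) (at p' (Flat.left F)))))) , refl

  basic-overlap : ∀ {i j i₂ j₂ k} → Basic i j → Basic i₂ j₂ →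
    i < k → k < j → i₂ < k → k < j₂ → i ≡ i₂ × j ≡ j₂
  basic-overlap (inj₁ (refl , _)) (inj₁ (refl , _)) a b c d'
    with refl ← suc-injective (trans (sym (suc-inside a b)) (suc-inside c d')) = refl , refl
  basic-overlap (inj₁ D) (inj₂ (_ , _ , F)) a b c d' = ⊥-elim (descent-flat D F a b c d')
  basic-overlap (inj₂ (_ , _ , F)) (inj₁ D) a b c d' = ⊥-elim (descent-flat D F c d' a b)
  basic-overlap (inj₂ (_ , _ , F)) (inj₂ (_ , _ , G)) a b c d' = flat-overlap F G a b c d'

  -- Monotone label sequences.

  Ascending : ℕ → Set
  Ascending j = ∀ {k m} → k ≤ m → m < j → l k ≤ l m

  Descending : Set
  Descending = ∀ {k m} → k ≤ m → m < d → l m ≤ l k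

  descent-or-ascending : ∀ j → (Σ ℕ λ k → suc k < j × l (suc k) < l k) ⊎ Ascending j
  descent-or-ascending zero = inj₂ λ _ ()
  descent-or-ascending (suc zero) = inj₂ λ { z≤n (s≤s z≤n) → ≤-refl }
  descent-or-ascending (suc (suc j)) with descent-or-ascending (suc j) | l (suc j) <? l j
  ... | inj₁ (k , k<j , lt) | _ = inj₁ (k , m<n⇒m<1+n k<j , lt)
  ... | inj₂ asc | yes lt = inj₁ (j , ≤-refl , lt)
  ... | inj₂ asc | no ≮ = inj₂ extended
    where
    extended : Ascending (2 + j)
    extended {k} {m} k≤m (s≤s m≤) with m≤n⇒m<n∨m≡n m≤ | m≤n⇒m<n∨m≡n k≤m
    ... | inj₁ m< | _ = asc k≤m m<
    ... | inj₂ refl | inj₁ (s≤s k≤j) = ≤-trans (asc k≤j ≤-refl) (≮⇒≥ ≮)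
    ... | inj₂ refl | inj₂ refl = ≤-refl

  -- Where the value at p falls from c to 0, monotone labels force the
  -- c steps at p to be consecutive.
  fall : ∀ {t} p c → t ≤ d → 1 ≤ c → c ≤ f 0 p → f t p ≡ 0 →
    (∀ {k k₂ m} → k ≤ m → m ≤ k₂ → k₂ < t → l k ≡ p → l k₂ ≡ p → l m ≡ p) →
    Σ ℕ λ k → Σ ℕ λ j → k < j × j ≤ t × f k p ≡ c × f j p ≡ 0 × c + k ≡ j ×
      (∀ m → k ≤ m → m < j → l m ≡ p)
  fall {t} p c t≤d 1≤c c≤ ft≡0 between
    with crossing p c z≤n t≤d c≤ (subst (_< c) (sym ft≡0) 1≤c)
  ... | k , _ , k<t , lk≡p , fk≡c
    with crossing p 1 (<⇒≤ k<t) t≤d (subst (1 ≤_) (sym fk≡c) 1≤c) (subst (_< 1) (sym ft≡0) ≤-refl)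
  ... | k₂ , k≤k₂ , k₂<t , refl , fk₂≡1 =
    k , suc k₂ , s≤s k≤k₂ , k₂<t , fk≡c , gone , total , same
    where
    gone : f (suc k₂) p ≡ 0
    gone = suc-injective (trans (sym (drops k₂ (≤-trans k₂<t t≤d))) fk₂≡1)
    same : ∀ m → k ≤ m → m < suc k₂ → l m ≡ p
    same m k≤m (s≤s m≤k₂) = between k≤m m≤k₂ k₂<t lk≡p refl
    total : c + k ≡ suc k₂
    total = trans (cong (_+ k) (sym fk≡c))
      (trans (constant-drop p (m≤n⇒m≤1+n k≤k₂) (≤-trans k₂<t t≤d) same) (cong (_+ suc k₂) gone))

  module _ (leftmost : ∀ k → k < d → f k (l k) ≡ 1 → ¬ LeftOne (f k) (l k)) where

    -- Let `c` be the value at `p'` at time `j`. Ascending labels make the last `c` steps at `p`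
    -- consecutive, and nothing to the left of `p` changes once they begin, so they form a flat
    -- block. For `c` equal to 1 the block would be a single step erasing a 1 that is not leftmost
    -- in its run.
    violation⇒basic : ∀ j → j ≤ d → Ascending j → Violation (f j) (f 0) →
      Σ ℕ λ i' → Σ ℕ λ j' → Basic i' j' × j' ≤ j
    violation⇒basic j j≤d asc (p' , p , p'<p , 1≤c , gap , fjp≡0 , c≤)
      with fall p (f j p') j≤d 1≤c c≤ fjp≡0
        (λ { {k} {k₂} {m} k≤m m≤k₂ k₂<j lk≡p lk₂≡p → ≤-antisym
          (subst (l m ≤_) lk₂≡p (asc m≤k₂ k₂<j))
          (subst (_≤ l m) lk≡p (asc k≤m (≤-<-trans m≤k₂ k₂<j))) })
    ... | k , j' , k<j' , j'≤j , fkp≡c , fj'p≡0 , total , same =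
      k , j' , inj₂ (p , p' , record
        { long = subst (2 + k ≤_) total (+-monoˡ-≤ k 2≤c)
        ; inside = ≤-trans j'≤j j≤d
        ; labels = same
        ; emptied = fj'p≡0
        ; left = p'<p
        ; gap = gap-k
        ; level = trans (cong (_+ k) (before p' p'<p)) total }) , j'≤j
      where
      k<d : k < d
      k<d = ≤-trans k<j' (≤-trans j'≤j j≤d)
      lk≡p : l k ≡ p
      lk≡p = same k ≤-refl k<j'
      before : ∀ q → q < p → f k q ≡ f j q
      before q q<p = sym (fixed q (≤-trans (<⇒≤ k<j') j'≤j) j≤d
        (λ m k≤m m<j lm≡q → <⇒≱ q<p (subst (p ≤_) lm≡q (subst (_≤ l m) lk≡p (asc k≤m m<j)))))
      gap-k : ∀ q → p' < q → q < p → f k q ≡ 0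
      gap-k q p'<q q<p = trans (before q q<p) (gap q p'<q q<p)
      2≤c : 2 ≤ f j p'
      2≤c with m≤n⇒m<n∨m≡n 1≤c
      ... | inj₁ 1<c = 1<c
      ... | inj₂ 1≡c = contradiction
        (p' , p'<p , trans (before p' p'<p) (sym 1≡c) , gap-k)
        (subst (λ q → f k q ≡ 1 → ¬ LeftOne (f k) q) lk≡p (leftmost k k<d)
          (trans fkp≡c (sym 1≡c)))

  -- Everything to the left of `l k` is still initial at time `k`. Initial entries are positive, so
  -- an offending 1 would be adjacent, and the entry erased next to it stays 0, against the
  -- condition on the final state.
  descending⇒leftmost : Descending → ∀ {n} → (∀ q → q < n → 1 ≤ f 0 q) → (∀ q → 1 ≤ f 0 q → q < n) →
    (∀ q → suc q < n → f 0 q ≡ 1 → f d (suc q) ≢ 0) →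
    ∀ k → k < d → f k (l k) ≡ 1 → ¬ LeftOne (f k) (l k)
  descending⇒leftmost desc {n} pos bound kept k k<d one (j , j<p , fkj≡1 , gap) =
    kept j (subst (_< n) adjacent p<n) (trans (sym (before j j<p)) fkj≡1)
      (subst (λ q → f d q ≡ 0) adjacent gone)
    where
    before : ∀ q → q < l k → f k q ≡ f 0 q
    before q q<p = fixed q z≤n (<⇒≤ k<d)
      (λ m _ m<k eq → <⇒≱ q<p (subst (l k ≤_) eq (desc (<⇒≤ m<k) k<d)))
    p<n : l k < n
    p<n = bound (l k) (≤-trans (≤-reflexive (sym one)) (antitone (l k) z≤n (<⇒≤ k<d)))
    adjacent : l k ≡ suc j
    adjacent = ≤-antisym (≮⇒≥ λ sj<p → contradiction
      (subst (1 ≤_) (trans (sym (before (suc j) sj<p)) (gap (suc j) ≤-refl sj<p))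
        (pos (suc j) (<-trans sj<p p<n))) λ ()) j<p
    gone : f d (l k) ≡ 0
    gone = n≤0⇒n≡0 (≤-trans (antitone (l k) k<d ≤-refl)
      (≤-reflexive (suc-injective (trans (sym (drops k k<d)) one))))

  -- With descending labels the second of two adjacent 1's could only be erased while the first is
  -- still in place, so it would not be leftmost.
  leftmost⇒kept : Descending → (∀ k → k < d → f k (l k) ≡ 1 → ¬ LeftOne (f k) (l k)) →
    ∀ q → f 0 q ≡ 1 → f 0 (suc q) ≡ 1 → f d (suc q) ≢ 0
  leftmost⇒kept desc lm q one one' gone
    with crossing (suc q) 1 z≤n ≤-refl (≤-reflexive (sym one')) (≤-reflexive (cong suc gone))
  ... | k , _ , k<d , lk≡ , fk≡1 = subst (λ p → f k p ≡ 1 → ¬ LeftOne (f k) p) lk≡ (lm k k<d) fk≡1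
    (q , ≤-refl , trans before one , λ m q<m m<sq → contradiction m<sq (≤⇒≯ q<m))
    where
    before : f k q ≡ f 0 q
    before = fixed q z≤n (<⇒≤ k<d)
      (λ m _ m<k eq → 1+n≰n (subst₂ _≤_ lk≡ eq (desc (<⇒≤ m<k) k<d)))

  -- Normality and coverage.

  -- Normality at one position, without the condition on runs of 1's. The third case says that an
  -- erased entry of at least 2 does not open its run; an erased 1 falls under the second case.
  NormalAt : ℕ → Set
  NormalAt p = f d p ≡ f 0 p ⊎ suc (f d p) ≡ f 0 p ⊎
    (f d p ≡ 0 × 2 ≤ f 0 p × Σ ℕ λ p' → p ≡ suc p' × f 0 p' ≡ f 0 p)

  Covered : Set
  Covered = ∀ k → suc k < d → Σ ℕ λ i → Σ ℕ λ j → Basic i j × i < suc k × suc k < j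

  -- All earlier labels are at least `l k` and different from it, hence lie strictly to its right.
  untouched-left : Descending → ∀ {k} → k ≤ d → (∀ m → m < k → l m ≢ l k) → k < d →
    ∀ q → q ≤ l k → f k q ≡ f 0 q
  untouched-left desc k≤d first k<d q q≤p = fixed q z≤n k≤d
    (λ m _ m<k lm≡q → first m m<k (≤-antisym (subst (_≤ l _) (sym lm≡q) q≤p) (desc (<⇒≤ m<k) k<d)))

  first-visit : ∀ {k p} → k ≤ d → f k p ≡ f 0 p → ∀ m → m < k → l m ≢ p
  first-visit k≤d fk≡f0 m m<k refl =
    <-irrefl fk≡f0 (<-≤-trans (drops< m<k k≤d) (antitone _ z≤n (≤-trans (<⇒≤ m<k) k≤d)))

  -- If times `m` and `suc m` do not form a descent, they lower the same position `p`, so `p` loses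
  -- at least 2 and normality forces it to be erased. The steps from its first to its last visit are
  -- then consecutive and form a flat block.
  normal⇒covered : Descending → (∀ p → NormalAt p) → Covered
  normal⇒covered desc normal m m<d with l (suc m) <? l m
  ... | yes lt = m , 2 + m , inj₁ (refl , m<d , lt) , ≤-refl , ≤-refl
  ... | no ≮ = cover (normal (l m))
    where
    p = l m
    p≡ : l (suc m) ≡ p
    p≡ = ≤-antisym (desc (n≤1+n m) m<d) (≮⇒≥ ≮)
    end<mid : f d p < f (suc m) p
    end<mid = subst (λ q → f d q < f (suc m) q) p≡ (drops< m<d ≤-refl)
    mid<start : f (suc m) p < f 0 p
    mid<start = <-≤-trans (drops< ≤-refl (<⇒≤ m<d)) (antitone p z≤n (<⇒≤ (<-trans (n<1+n m) m<d)))
    cover : NormalAt p → Σ ℕ λ i → Σ ℕ λ j → Basic i j × i < suc m × suc m < j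
    cover (inj₁ eq) = contradiction (<-trans end<mid mid<start) (<-irrefl eq)
    cover (inj₂ (inj₁ eq)) = contradiction (subst (suc (suc (f d p)) ≤_) (sym eq)
      (≤-trans (s≤s end<mid) mid<start)) (<-irrefl refl)
    cover (inj₂ (inj₂ (gone , 2≤w , p' , p≡suc , w≡)))
      with fall p (f 0 p) ≤-refl (<⇒≤ 2≤w) ≤-refl gone
        (λ { {a} {b} {c} a≤c c≤b b<d la≡p lb≡p → ≤-antisym
          (subst (l c ≤_) la≡p (desc a≤c (≤-<-trans c≤b b<d)))
          (subst (_≤ l c) lb≡p (desc c≤b b<d)) })
    ... | k , j , k<j , j≤d , fk≡ , fj≡0 , total , same =
      k , j , inj₂ (p , p' , record
        { long = subst (2 + k ≤_) total (+-monoˡ-≤ k 2≤w)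
        ; inside = j≤d
        ; labels = same
        ; emptied = fj≡0
        ; left = p'<p
        ; gap = λ q p'<q q<p → contradiction (subst (q <_) p≡suc q<p) (<⇒≱ (s≤s p'<q))
        ; level = trans (cong (_+ k) (trans before w≡)) total }) ,
      -- The block starts at the first visit of `p`, hence no later than `m`; it ends with `p`
      -- empty, hence after `suc m`, when `p` is still to be lowered.
      s≤s (≮⇒≥ λ m<k → first-visit (<⇒≤ k<d) fk≡ m m<k refl) ,
      ≰⇒> λ j≤ → contradiction (subst (f d p <_) (n≤0⇒n≡0 (subst (f (suc m) p ≤_) fj≡0
        (antitone p j≤ (<⇒≤ m<d)))) end<mid) λ ()
      where
      k<d : k < d
      k<d = ≤-trans k<j j≤d
      lk≡p : l k ≡ p
      lk≡p = same k ≤-refl k<j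
      p'<p : p' < p
      p'<p = subst (p' <_) (sym p≡suc) ≤-refl
      before : f k p' ≡ f 0 p'
      before = untouched-left desc (<⇒≤ k<d)
        (λ a a<k eq → first-visit (<⇒≤ k<d) fk≡ a a<k (trans eq lk≡p)) k<d p'
        (subst (p' ≤_) (sym lk≡p) (<⇒≤ p'<p))

  covered⇒descending : Covered → ∀ k → suc k < d → l (suc k) ≤ l k
  covered⇒descending cov k k<d with cov k k<d
  ... | i , j , inj₁ (refl , _ , lt) , i<k , s≤s (s≤s k≤i) with refl ← ≤-antisym k≤i (s≤s⁻¹ i<k) = <⇒≤ lt
  ... | i , j , inj₂ (_ , _ , F) , i<k , k<j = ≤-reflexive
    (trans (Flat.labels F (suc k) (<⇒≤ i<k) k<j)
      (sym (Flat.labels F k (s≤s⁻¹ i<k) (<-trans (n<1+n k) k<j))))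

  -- Consider the first visit `k` of a lowered position. If no label follows or the next one is
  -- smaller, the entry is lowered just once. If the next label is equal, the basic interval around
  -- `suc k` is no descent; as a flat block it must start at the first visit. It empties the entry,
  -- whose left neighbour is equal and, by positivity of the initial entries, adjacent.
  covered⇒normal : Descending → Covered → ∀ {n} → (∀ q → q < n → 1 ≤ f 0 q) →
    ∀ p → p < n → NormalAt p
  covered⇒normal desc cov pos p p<n with m≤n⇒m<n∨m≡n (antitone p z≤n (≤-refl {d}))
  ... | inj₂ eq = inj₁ eq
  ... | inj₁ lt with crossing p (f 0 p) z≤n ≤-refl ≤-refl lt
  ... | k , _ , k<d , refl , fk≡ = inj₂ (by-next (m≤n⇒m<n∨m≡n k<d))
    where
    left-eq = untouched-left desc (<⇒≤ k<d) (first-visit (<⇒≤ k<d) fk≡) k<d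
    once : f d (l k) ≡ f (suc k) (l k) → suc (f d (l k)) ≡ f 0 (l k)
    once eq = trans (cong suc eq) (trans (sym (drops k k<d)) fk≡)
    by-next : suc k < d ⊎ suc k ≡ d → suc (f d (l k)) ≡ f 0 (l k) ⊎
      (f d (l k) ≡ 0 × 2 ≤ f 0 (l k) × Σ ℕ λ p' → l k ≡ suc p' × f 0 p' ≡ f 0 (l k))
    by-next (inj₂ refl) = inj₁ (once refl)
    by-next (inj₁ sk<d) with m≤n⇒m<n∨m≡n (desc (n≤1+n k) sk<d)
    ... | inj₁ next< = inj₁ (once (fixed (l k) k<d ≤-refl
      (λ m sk≤m m<d eq → <-irrefl eq (≤-<-trans (desc sk≤m m<d) next<))))
    ... | inj₂ next≡ with cov k sk<d
    ...   | i , j , inj₁ (refl , _ , lt') , i<k , s≤s (s≤s k≤i)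
            with refl ← ≤-antisym k≤i (s≤s⁻¹ i<k) = contradiction next≡ (<⇒≢ lt')
    ...   | i , j , inj₂ (p₀ , p' , F) , i<k , k<j
            with refl ← Flat.labels F k (s≤s⁻¹ i<k) (<-trans (n<1+n k) k<j)
            with m≤n⇒m<n∨m≡n (s≤s⁻¹ i<k)
    ...     | inj₁ i<k' = contradiction (Flat.labels F i ≤-refl (<-trans i<k k<j))
                (first-visit (<⇒≤ k<d) fk≡ i i<k')
    ...     | inj₂ refl = inj₂ (gone , 2≤ , p' , adjacent , level)
      where
      gone : f d (l k) ≡ 0
      gone = n≤0⇒n≡0 (subst (f d (l k) ≤_) (Flat.emptied F) (antitone _ (Flat.inside F) ≤-refl))
      level : f 0 p' ≡ f 0 (l k)
      level = trans (sym (left-eq p' (<⇒≤ (Flat.left F)))) (trans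
        (+-cancelʳ-≡ k _ _ (trans (Flat.level F) (sym (Flat.start F)))) fk≡)
      2≤ : 2 ≤ f 0 (l k)
      2≤ = subst (2 ≤_) (trans (left-eq p' (<⇒≤ (Flat.left F))) level) (level-positive F)
      adjacent : l k ≡ suc p'
      adjacent = ≤-antisym (≮⇒≥ λ lt → contradiction
        (subst (1 ≤_) (trans (sym (left-eq (suc p') (<⇒≤ lt))) (Flat.gap F (suc p') ≤-refl lt))
          (pos (suc p') (<-trans lt p<n))) λ ()) (Flat.left F)

  -- Tilings by basic intervals.

  -- Pairs record open intervals: the interior of `(s , suc s')` ends at `s'`, so the next tile
  -- starts at `s'` and not at `suc s'`. In `last` only the final label remains, and no interior
  -- time.
  data Tiles : ℕ → List (ℕ × ℕ) → Set where
    last : ∀ {s} → suc s ≡ d → Tiles s []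
    tile : ∀ {s s' Is} → Basic s (suc s') → Tiles s' Is → Tiles s ((s , suc s') ∷ Is)

  -- The basic interval around `suc s` must start at `s`. Otherwise it would share the interior time
  -- `s` with the preceding tile, which ends at `suc s`, and so coincide with it, although it
  -- reaches further.
  tiling : Covered → 1 ≤ d → Σ (List (ℕ × ℕ)) (Tiles 0)
  tiling cov 1≤d = from d 0 1≤d ≤-refl (inj₁ refl)
    where
    from : ∀ fuel s → s < d → d ≤ s + fuel → s ≡ 0 ⊎ (Σ ℕ λ i → Basic i (suc s)) →
      Σ (List (ℕ × ℕ)) (Tiles s)
    from zero s s<d enough _ = contradiction (subst (d ≤_) (+-identityʳ s) enough) (<⇒≱ s<d)
    from (suc fuel) s s<d enough previous with m≤n⇒m<n∨m≡n s<d
    ... | inj₂ eq = [] , last eq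
    ... | inj₁ ss<d with cov s ss<d
    ...   | i , zero , _ , _ , ()
    ...   | i , suc s' , b , i<ss , s≤s s<s' with m≤n⇒m<n∨m≡n (s≤s⁻¹ i<ss)
    ...     | inj₂ refl = let Is , T = from fuel s' (basic-inside b)
                                (≤-trans (subst (d ≤_) (+-suc s fuel) enough) (+-monoˡ-≤ fuel s<s'))
                                (inj₂ (s , b))
                          in _ , tile b T
    ...     | inj₁ i<s with previous
    ...       | inj₁ refl = contradiction i<s λ ()
    ...       | inj₂ (i₀ , b₀) = contradiction
                  (suc-injective (proj₂ (basic-overlap b₀ b (s≤s⁻¹ (basic-long b₀)) ≤-refl i<s (m<n⇒m<1+n s<s'))))
                  (<⇒≢ s<s')

  tiles-basic : ∀ {s Is i j} → Tiles s Is → (i , j) ∈ Is → Basic i j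
  tiles-basic (tile b _) (here refl) = b
  tiles-basic (tile _ T) (there in-Is) = tiles-basic T in-Is

  tiles-cover : ∀ {s Is k} → Tiles s Is → s < k → k < d →
    Σ ℕ λ i → Σ ℕ λ j → (i , j) ∈ Is × i < k × k < j
  tiles-cover (last refl) s<k k<d = contradiction s<k (<⇒≱ k<d)
  tiles-cover {k = k} (tile {s} {s'} b T) s<k k<d with k ≤? s'
  ... | yes k≤s' = s , suc s' , here refl , s<k , s≤s k≤s'
  ... | no k≰s' = let i , j , in-Is , rest = tiles-cover T (≰⇒> k≰s') k<d
                  in i , j , there in-Is , rest

  tiles-sorted : ∀ {s Is} → Tiles s Is → Linked (λ a b → proj₁ a < proj₁ b) Is
  tiles-sorted (last _) = []
  tiles-sorted (tile b (last _)) = [-]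
  tiles-sorted (tile b T@(tile _ _)) = s≤s⁻¹ (basic-long b) ∷ tiles-sorted T

  tiles-complete : ∀ {Is i j} → Tiles 0 Is → Basic i j → (i , j) ∈ Is
  tiles-complete {i = i} T b
    with tiles-cover T (s≤s z≤n) (≤-trans (basic-long b) (basic-inside b))
  ... | i₂ , j₂ , in-Is , i₂< , <j₂
    with refl , refl ← basic-overlap b (tiles-basic T in-Is) (n<1+n i) (basic-long b) i₂< <j₂ = in-Is

  private
    one-drop : ∀ h → (suc h ∸ h) ⊓ 2 ≡ suc ((h ∸ h) ⊓ 2)
    one-drop zero = refl
    one-drop (suc h) = one-drop h

  -- At a descent the position `l s` is settled by this step, so its term falls from 1 to 0. A flat
  -- tile is followed only up to `s'`, one step before its end: the entry falls from at least 2 to 1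
  -- with final value 0, and its truncated term falls from 2 to 1.
  tiles-count : Descending → ∀ {n} → (∀ q → 1 ≤ f 0 q → q < n) → ∀ {s Is} → s < d → Tiles s Is →
    cost n (f s) (f d) ≡ suc (length Is)
  tiles-count desc {n} bound = go
    where
    in-range : ∀ {s} → s < d → l s < n
    in-range {s} s<d = bound (l s) (≤-trans (subst (1 ≤_) (sym (drops s s<d)) (s≤s z≤n))
      (antitone (l s) z≤n (<⇒≤ s<d)))
    single-step : ∀ {s} → s < d → f (suc s) (l s) ≡ f d (l s) →
      cost n (f s) (f d) ≡ suc (cost n (f (suc s)) (f d))
    single-step {s} s<d settled = cost-step n (in-range s<d) (λ q q≢ → sym (keeps s s<d q q≢))
      (trans (cong (λ x → (x ∸ f d (l s)) ⊓ 2) (trans (drops s s<d) (cong suc settled)))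
        (trans (one-drop (f d (l s))) (cong (λ x → suc ((x ∸ f d (l s)) ⊓ 2)) (sym settled))))
    go : ∀ {s Is} → s < d → Tiles s Is → cost n (f s) (f d) ≡ suc (length Is)
    go s<d (last refl) = trans (single-step s<d refl) (cong suc (cost-refl n (f d)))
    go s<d (tile {s} (inj₁ (refl , j≤d , lt)) T) = trans
      (single-step s<d (sym (fixed (l s) s<d ≤-refl
        (λ m ss≤m m<d eq → <-irrefl eq (≤-<-trans (desc ss≤m m<d) lt)))))
      (cong suc (go j≤d T))
    go s<d (tile {s} {s'} (inj₂ (p , p' , F)) T) = trans
      (cost-step n (subst (_< n) ls≡p (in-range s<d))
        (λ q q≢p → sym (Flat.unchanged F q q≢p s≤s' (n≤1+n s')))
        change)
      (cong suc (go (Flat.inside F) T))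
      where
      s≤s' : s ≤ s'
      s≤s' = <⇒≤ (s≤s⁻¹ (Flat.long F))
      ls≡p : l s ≡ p
      ls≡p = Flat.labels F s ≤-refl (s≤s s≤s')
      gone : f d p ≡ 0
      gone = n≤0⇒n≡0 (subst (f d p ≤_) (Flat.emptied F) (antitone p (Flat.inside F) ≤-refl))
      before : 2 ≤ f s p
      before = +-cancelʳ-≤ s 2 _ (subst (2 + s ≤_) (sym (Flat.start F)) (Flat.long F))
      after : f s' p ≡ 1
      after = +-cancelʳ-≡ s' _ 1 (Flat.remaining F s≤s' (n≤1+n s'))
      change : (f s p ∸ f d p) ⊓ 2 ≡ suc ((f s' p ∸ f d p) ⊓ 2)
      change rewrite gone | after = m≥n⇒m⊓n≡n before

-- Lowering an entry, letter sums and the subword order.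

sub1-at : ∀ x i → 1 ≤ x ! i → x ! i ≡ suc (sub1 x i ! i)
sub1-at (suc a ∷ x) zero _ = refl
sub1-at (a ∷ x) (suc i) 1≤ = sub1-at x i 1≤

sub1-off : ∀ x i q → q ≢ i → sub1 x i ! q ≡ x ! q
sub1-off [] i q _ = refl
sub1-off (a ∷ x) zero zero q≢ = contradiction refl q≢
sub1-off (a ∷ x) zero (suc q) _ = refl
sub1-off (a ∷ x) (suc i) zero _ = refl
sub1-off (a ∷ x) (suc i) (suc q) q≢ = sub1-off x i q (q≢ ∘ cong suc)

sub1-length : ∀ x i → length (sub1 x i) ≡ length x
sub1-length [] i = refl
sub1-length (a ∷ x) zero = refl
sub1-length (a ∷ x) (suc i) = cong suc (sub1-length x i)

sub1-comm : ∀ x i j → sub1 (sub1 x i) j ≡ sub1 (sub1 x j) i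
sub1-comm [] i j = refl
sub1-comm (a ∷ x) zero zero = refl
sub1-comm (a ∷ x) zero (suc j) = refl
sub1-comm (a ∷ x) (suc i) zero = refl
sub1-comm (a ∷ x) (suc i) (suc j) = cong (a ∷_) (sub1-comm x i j)

!-bound : ∀ x i → 1 ≤ x ! i → i < length x
!-bound (a ∷ x) zero _ = s≤s z≤n
!-bound (a ∷ x) (suc i) 1≤ = s≤s (!-bound x i 1≤)

sum-sub1 : ∀ x i → 1 ≤ x ! i → sum x ≡ suc (sum (sub1 x i))
sum-sub1 (suc a ∷ x) zero _ = refl
sum-sub1 (a ∷ x) (suc i) 1≤ = trans (cong (a +_) (sum-sub1 x i 1≤)) (+-suc a _)

sum-nz : ∀ x → sum (nz x) ≡ sum x
sum-nz [] = refl
sum-nz (zero ∷ x) = sum-nz x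
sum-nz (suc a ∷ x) = cong (suc a +_) (sum-nz x)

nz-pos : ∀ {w} → Pos w → nz w ≡ w
nz-pos [] = refl
nz-pos (s≤s z≤n ∷ ps) = cong (_ ∷_) (nz-pos ps)

≼-refl : ∀ x → x ≼ x
≼-refl [] = nil
≼-refl (a ∷ x) = take ≤-refl (≼-refl x)

≼-tail : ∀ {a x y} → (a ∷ x) ≼ y → x ≼ y
≼-tail (skip r) = skip (≼-tail r)
≼-tail (take _ r) = skip r

≼-trans : ∀ {x y z} → x ≼ y → y ≼ z → x ≼ z
≼-trans nil _ = nil
≼-trans r@(skip _) (skip s) = skip (≼-trans r s)
≼-trans r@(take _ _) (skip s) = skip (≼-trans r s)
≼-trans (skip r) (take _ s) = skip (≼-trans r s)
≼-trans (take a≤b r) (take b≤c s) = take (≤-trans a≤b b≤c) (≼-trans r s)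

nz-sub1-≼ : ∀ x i → nz (sub1 x i) ≼ nz x
nz-sub1-≼ [] i = nil
nz-sub1-≼ (zero ∷ x) zero = ≼-refl (nz x)
nz-sub1-≼ (suc zero ∷ x) zero = skip (≼-refl (nz x))
nz-sub1-≼ (suc (suc a) ∷ x) zero = take (n≤1+n _) (≼-refl (nz x))
nz-sub1-≼ (zero ∷ x) (suc i) = nz-sub1-≼ x i
nz-sub1-≼ (suc a ∷ x) (suc i) = take ≤-refl (nz-sub1-≼ x i)

-- Label sequences and their states.

-- Label sequences without the leftmost-1 convention: they trace a chain of words, but need not be
-- its labels. `Valid` adds the convention.
Weak : List ℕ → List ℕ → Set
Weak η [] = ⊤
Weak η (i ∷ ls) = 1 ≤ η ! i × Weak (sub1 η i) ls

Ok : List ℕ → ℕ → Set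
Ok η i = 1 ≤ η ! i × (η ! i ≡ 1 → ¬ LeftOne (η !_) i)

Valid : List ℕ → List ℕ → Set
Valid η [] = ⊤
Valid η (i ∷ ls) = Ok η i × Valid (sub1 η i) ls

valid⇒weak : ∀ {η} ls → Valid η ls → Weak η ls
valid⇒weak [] _ = tt
valid⇒weak (i ∷ ls) ((1≤ , _) , v) = 1≤ , valid⇒weak ls v

state : List ℕ → List ℕ → ℕ → List ℕ
state η ls zero = η
state η [] (suc k) = η
state η (i ∷ ls) (suc k) = state (sub1 η i) ls k

run : List ℕ → List ℕ → List ℕ
run = foldl sub1

state-run : ∀ η ls → state η ls (length ls) ≡ run η ls
state-run η [] = refl
state-run η (i ∷ ls) = state-run (sub1 η i) ls

words : List ℕ → List ℕ → List Word
words η [] = []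
words η (i ∷ ls) = nz (sub1 η i) ∷ words (sub1 η i) ls

words-length : ∀ η ls → length (words η ls) ≡ length ls
words-length η [] = refl
words-length η (i ∷ ls) = cong suc (words-length (sub1 η i) ls)

drops : ∀ η ls → Weak η ls → ∀ k → k < length ls →
  state η ls k ! (ls ! k) ≡ suc (state η ls (suc k) ! (ls ! k))
drops η (i ∷ ls) (1≤ , _) zero _ = sub1-at η i 1≤
drops η (i ∷ ls) (_ , wk) (suc k) (s≤s k<) = drops (sub1 η i) ls wk k k<

keeps : ∀ η ls → ∀ k → k < length ls → ∀ q → q ≢ ls ! k →
  state η ls (suc k) ! q ≡ state η ls k ! q
keeps η (i ∷ ls) zero _ q q≢ = sub1-off η i q q≢
keeps η (i ∷ ls) (suc k) (s≤s k<) q q≢ = keeps (sub1 η i) ls k k< q q≢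

leftmost : ∀ η ls → Valid η ls → ∀ k → k < length ls →
  state η ls k ! (ls ! k) ≡ 1 → ¬ LeftOne (state η ls k !_) (ls ! k)
leftmost η (i ∷ ls) ((_ , lm) , _) zero _ = lm
leftmost η (i ∷ ls) (_ , v) (suc k) (s≤s k<) = leftmost (sub1 η i) ls v k k<

module ChainWalk (η ls : List ℕ) (wk : Weak η ls) where
  open Walk (λ k p → state η ls k ! p) (ls !_) (length ls) (drops η ls wk) (keeps η ls) public

-- Labels of chains of words

-- The equation compares the word with itself shifted by one letter, which forces every nonzero
-- entry up to `i` to be a 1.
before-one : ∀ x i → 1 ≤ x ! i → nz x ≡ 1 ∷ nz (sub1 x i) → x ! i ≡ 1 ×
  (LeftOne (x !_) i ⊎ (∀ k → k < i → x ! k ≡ 0))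
before-one (zero ∷ x) (suc i) 1≤ eq with before-one x i 1≤ eq
... | one , inj₁ (j , j<i , xj , gap) = one , inj₁ (suc j , s≤s j<i , xj ,
  λ { (suc k) (s≤s a) (s≤s b) → gap k a b })
... | one , inj₂ none = one , inj₂ λ { zero _ → refl ; (suc k) (s≤s k<) → none k k< }
before-one (suc zero ∷ x) zero _ _ = refl , inj₂ λ _ ()
before-one (suc (suc a) ∷ x) zero _ eq = contradiction (∷-injectiveˡ eq) λ ()
before-one (suc (suc a) ∷ x) (suc i) _ eq = contradiction (∷-injectiveˡ eq) λ ()
before-one (suc zero ∷ x) (suc i) 1≤ eq with before-one x i 1≤ (∷-injectiveʳ eq)
... | one , inj₁ (j , j<i , xj , gap) = one , inj₁ (suc j , s≤s j<i , xj ,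
  λ { (suc k) (s≤s a) (s≤s b) → gap k a b })
... | one , inj₂ none = one , inj₁ (0 , s≤s z≤n , refl ,
  λ { (suc k) _ (s≤s k<) → none k k< })

private
  ok-tail : ∀ {a x i} → Ok (a ∷ x) (suc i) → Ok x i
  ok-tail (1≤ , lm) = 1≤ , λ { one (j , j<i , xj , gap) → lm one (suc j , s≤s j<i , xj ,
    λ { (suc k) (s≤s a) (s≤s b) → gap k a b }) }

  -- For `a` at least 2 the first letters differ. For `a` equal to 1, `before-one` exhibits a 1 as
  -- the nearest nonzero entry to the left of `suc i`.
  head-step : ∀ a x i → 1 ≤ a → Ok (a ∷ x) (suc i) → nz (a ∸ 1 ∷ x) ≡ nz (a ∷ sub1 x i) → ⊥
  head-step (suc zero) x i _ (1≤ , lm) eq with before-one x i 1≤ eq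
  ... | one , inj₁ (j , j<i , xj , gap) = lm one (suc j , s≤s j<i , xj ,
    λ { (suc k) (s≤s a) (s≤s b) → gap k a b })
  ... | one , inj₂ none = lm one (0 , s≤s z≤n , refl , λ { (suc k) _ (s≤s k<) → none k k< })
  head-step (suc (suc a)) x i _ _ eq = contradiction (∷-injectiveˡ eq) (<⇒≢ ≤-refl)

-- The leftmost-1 convention makes the label a function of the two words. Common heads are stripped
-- until one of the subtractions happens at the head, where `head-step` decides.
step-unique : ∀ η i i' → Ok η i → Ok η i' → nz (sub1 η i) ≡ nz (sub1 η i') → i ≡ i'
step-unique [] i i' (() , _)
step-unique (a ∷ x) zero zero _ _ _ = refl
step-unique (a ∷ x) zero (suc i') (1≤a , _) ok eq = ⊥-elim (head-step a x i' 1≤a ok eq)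
step-unique (a ∷ x) (suc i) zero ok (1≤a , _) eq = ⊥-elim (head-step a x i 1≤a ok (sym eq))
step-unique (zero ∷ x) (suc i) (suc i') ok ok' eq =
  cong suc (step-unique x i i' (ok-tail ok) (ok-tail ok') eq)
step-unique (suc a ∷ x) (suc i) (suc i') ok ok' eq =
  cong suc (step-unique x i i' (ok-tail ok) (ok-tail ok') (∷-injectiveʳ eq))

valid⇒labels : ∀ η ls → Valid η ls → Labels η (words η ls) ls (run η ls)
valid⇒labels η [] _ = done
valid⇒labels η (i ∷ ls) ((1≤ , lm) , v) =
  step (!-bound η i 1≤ , 1≤ , refl , refl , lm) (valid⇒labels (sub1 η i) ls v)

labels⇒valid : ∀ {η ys ls e} → Labels η ys ls e →
  Valid η ls × ys ≡ words η ls × e ≡ run η ls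
labels⇒valid done = tt , refl , refl
labels⇒valid (step (_ , 1≤ , refl , refl , lm) L) with labels⇒valid L
... | v , refl , e≡ = ((1≤ , lm) , v) , refl , e≡

words-injective : ∀ η ls ls' → Valid η ls → Valid η ls' → words η ls ≡ words η ls' → ls ≡ ls'
words-injective η [] [] _ _ _ = refl
words-injective η (i ∷ ls) (i' ∷ ls') (ok , v) (ok' , v') eq
  with refl ← step-unique η i i' ok ok' (∷-injectiveˡ eq) =
  cong (i ∷_) (words-injective (sub1 η i) ls ls' v v' (∷-injectiveʳ eq))

nz-sub1-decr : ∀ x i → 1 ≤ x ! i → Covers (nz x) (nz (sub1 x i))
nz-sub1-decr (suc zero ∷ x) zero _ = 0 , s≤s z≤n , refl
nz-sub1-decr (suc (suc a) ∷ x) zero _ = 0 , s≤s z≤n , refl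
nz-sub1-decr (zero ∷ x) (suc i) 1≤ = nz-sub1-decr x i 1≤
nz-sub1-decr (suc a ∷ x) (suc i) 1≤ with nz-sub1-decr x i 1≤
... | j , j< , eq = suc j , s≤s j< , trans (cong (suc a ∷_) eq) (decr-suc a (nz x) j)
  where
  decr-suc : ∀ a y j → suc a ∷ decr y j ≡ decr (suc a ∷ y) (suc j)
  decr-suc zero y j = refl
  decr-suc (suc a) y j = refl

covers⇒sub1 : ∀ x i → i < length (nz x) → Σ ℕ λ i' → 1 ≤ x ! i' × nz (sub1 x i') ≡ decr (nz x) i
covers⇒sub1 (zero ∷ x) i i< with covers⇒sub1 x i i<
... | i' , rest = suc i' , rest
covers⇒sub1 (suc zero ∷ x) zero _ = 0 , s≤s z≤n , refl
covers⇒sub1 (suc (suc a) ∷ x) zero _ = 0 , s≤s z≤n , refl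
covers⇒sub1 (suc zero ∷ x) (suc i) (s≤s i<) with covers⇒sub1 x i i<
... | i' , 1≤ , eq = suc i' , 1≤ , cong (1 ∷_) eq
covers⇒sub1 (suc (suc a) ∷ x) (suc i) (s≤s i<) with covers⇒sub1 x i i<
... | i' , 1≤ , eq = suc i' , 1≤ , cong (suc (suc a) ∷_) eq

-- Erasing whole entries and moving a deletion to the leftmost 1.

zeroAt : List ℕ → ℕ → List ℕ
zeroAt [] i = []
zeroAt (a ∷ x) zero = 0 ∷ x
zeroAt (a ∷ x) (suc i) = a ∷ zeroAt x i

run-replicate-suc : ∀ a x m i → run (a ∷ x) (replicate m (suc i)) ≡ a ∷ run x (replicate m i)
run-replicate-suc a x zero i = refl
run-replicate-suc a x (suc m) i = run-replicate-suc a (sub1 x i) m i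

run-replicate-zero : ∀ a x m → run (a ∷ x) (replicate m 0) ≡ (a ∸ m) ∷ x
run-replicate-zero a x zero = refl
run-replicate-zero a x (suc m) = trans (run-replicate-zero (a ∸ 1) x m)
  (cong (_∷ x) (∸-+-assoc a 1 m))

run-zeroAt : ∀ x i {c} → x ! i ≡ c → run x (replicate c i) ≡ zeroAt x i
run-zeroAt [] i refl = refl
run-zeroAt (a ∷ x) zero refl = trans (run-replicate-zero a x a) (cong (_∷ x) (n∸n≡0 a))
run-zeroAt (a ∷ x) (suc i) {c} eq = trans (run-replicate-suc a x c i) (cong (a ∷_) (run-zeroAt x i eq))

weak-replicate : ∀ x m i → m ≤ x ! i → Weak x (replicate m i)
weak-replicate x zero i _ = tt
weak-replicate x (suc m) i m< = 1≤ , weak-replicate (sub1 x i) m i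
  (s≤s⁻¹ (subst (suc m ≤_) (sub1-at x i 1≤) m<))
  where
  1≤ : 1 ≤ x ! i
  1≤ = ≤-trans (s≤s z≤n) m<

nz-zeroAt-first : ∀ x i → 1 ≤ x ! i → (∀ k → k < i → x ! k ≡ 0) → nz x ≡ x ! i ∷ nz (zeroAt x i)
nz-zeroAt-first (suc a ∷ x) zero _ _ = refl
nz-zeroAt-first (a ∷ x) (suc i) 1≤ none with none 0 (s≤s z≤n)
... | refl = nz-zeroAt-first x i 1≤ (λ k k< → none (suc k) (s≤s k<))

-- Serves twice: for entries equal to 1 it moves a deletion leftwards within a run, and for larger
-- entries it provides the detour around a flat block.
nz-zeroAt : ∀ x j i → j < i → 1 ≤ x ! i → x ! j ≡ x ! i → (∀ k → j < k → k < i → x ! k ≡ 0) →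
  nz (zeroAt x j) ≡ nz (zeroAt x i)
nz-zeroAt [] j i _ () _ _
nz-zeroAt (zero ∷ x) zero (suc i) _ 1≤ eq _ = contradiction (subst (1 ≤_) (sym eq) 1≤) λ ()
nz-zeroAt (suc a ∷ x) zero (suc i) _ 1≤ eq gap = trans
  (nz-zeroAt-first x i 1≤ (λ k k< → gap (suc k) (s≤s z≤n) (s≤s k<)))
  (cong (_∷ nz (zeroAt x i)) (sym eq))
nz-zeroAt (zero ∷ x) (suc j) (suc i) (s≤s j<i) 1≤ eq gap =
  nz-zeroAt x j i j<i 1≤ eq (λ k a b → gap (suc k) (s≤s a) (s≤s b))
nz-zeroAt (suc a ∷ x) (suc j) (suc i) (s≤s j<i) 1≤ eq gap = cong (suc a ∷_)
  (nz-zeroAt x j i j<i 1≤ eq (λ k a b → gap (suc k) (s≤s a) (s≤s b)))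

leftOne-suc : ∀ {g i} → LeftOne g (suc i) → g i ≡ 1 ⊎ (g i ≡ 0 × LeftOne g i)
leftOne-suc {i = i} (j , s≤s j≤i , gj , gap) with m≤n⇒m<n∨m≡n j≤i
... | inj₁ j<i = inj₂ (gap i j<i ≤-refl , j , j<i , gj , λ k a b → gap k a (m<n⇒m<1+n b))
... | inj₂ refl = inj₁ gj

leftOne? : ∀ g i → Dec (LeftOne g i)
leftOne? g zero = no λ { (_ , () , _) }
leftOne? g (suc i) with g i ≟ 1 | g i ≟ 0 | leftOne? g i
... | yes one | _ | _ = yes (i , ≤-refl , one , λ k i<k k≤i → contradiction k≤i (<⇒≱ (s≤s i<k)))
... | no ≢1 | no ≢0 | _ = no λ near → [ ≢1 , ≢0 ∘ proj₁ ]′ (leftOne-suc near)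
... | no ≢1 | yes eq | no none = no λ near → [ ≢1 , none ∘ proj₂ ]′ (leftOne-suc near)
... | no ≢1 | yes eq | yes (j , j<i , gj , gap) = yes (j , m<n⇒m<1+n j<i , gj , gap')
  where
  gap' : ∀ k → j < k → k < suc i → g k ≡ 0
  gap' k j<k (s≤s k≤i) with m≤n⇒m<n∨m≡n k≤i
  ... | inj₁ k<i = gap k j<k k<i
  ... | inj₂ refl = eq

-- A deleted 1 is traded for the preceding 1 of its run until none precedes; the position decreases,
-- so fuel exceeding `i` suffices.
normalize-step : ∀ fuel x i → i < fuel → 1 ≤ x ! i →
  Σ ℕ λ i' → Ok x i' × nz (sub1 x i') ≡ nz (sub1 x i)
normalize-step (suc fuel) x i (s≤s i≤) 1≤ with x ! i ≟ 1
... | no ≢1 = i , (1≤ , λ eq → contradiction eq ≢1) , refl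
... | yes one with leftOne? (x !_) i
...   | no none = i , (1≤ , λ _ → none) , refl
...   | yes (j , j<i , xj , gap) =
  map₂ (map₂ (λ eq → trans eq (trans (cong nz (run-zeroAt x j xj))
      (trans (nz-zeroAt x j i j<i 1≤ (trans xj (sym one)) gap) (cong nz (sym (run-zeroAt x i one)))))))
    (normalize-step fuel x j (≤-trans j<i i≤) (subst (1 ≤_) (sym xj) ≤-refl))

covers⇒ok : ∀ x y → Covers (nz x) y → Σ ℕ λ i → Ok x i × nz (sub1 x i) ≡ y
covers⇒ok x y (i , i< , refl) with covers⇒sub1 x i i<
... | i' , 1≤ , eq = map₂ (map₂ (λ eq' → trans eq' eq)) (normalize-step (suc i') x i' ≤-refl 1≤)

-- Together with `words-injective`, this lets each chain be replaced by its unique valid label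
-- sequence.
chain⇒labels : ∀ {u} η {x C} → ChainTo u x C → x ≡ nz η →
  Σ (List ℕ) λ ls → Valid η ls × C ≡ nz η ∷ words η ls × u ≡ nz (run η ls)
chain⇒labels η single x≡ = [] , tt , cong (_∷ []) x≡ , x≡
chain⇒labels η (cons {y = y} cov chain) refl with covers⇒ok η y cov
... | i , ok , eq with chain⇒labels (sub1 η i) chain (sym eq)
...   | ls , v , refl , u≡ = i ∷ ls , (ok , v) , refl , u≡

-- Splices a path of steps in front of a chain. Only membership of the old words is recorded, since
-- `chain⇒labels` finds the labels afresh.
weak⇒chain : ∀ {u} η ls {C} → Weak η ls → ChainTo u (nz (run η ls)) C →
  Σ (List Word) λ C' → ChainTo u (nz η) C' × (∀ {v} → v ∈ C → v ∈ C')
weak⇒chain η [] _ chain = _ , chain , λ v∈ → v∈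
weak⇒chain η (i ∷ ls) (1≤ , wk) chain with weak⇒chain (sub1 η i) ls wk chain
... | C' , chain' , sub = nz η ∷ C' , cons (nz-sub1-decr η i 1≤) chain' , λ v∈ → there (sub v∈)

words-chain : ∀ η ls → Weak η ls → ChainTo (nz (run η ls)) (nz η) (nz η ∷ words η ls)
words-chain η [] _ = single
words-chain η (i ∷ ls) (1≤ , wk) = cons (nz-sub1-decr η i 1≤) (words-chain (sub1 η i) ls wk)

-- Skipped and basic intervals

violation-shift : ∀ {c a e x} → Violation (e !_) (x !_) → Violation ((c ∷ e) !_) ((a ∷ x) !_)
violation-shift (p' , p , p'<p , 1≤ , gap , rest) =
  suc p' , suc p , s≤s p'<p , 1≤ , (λ { (suc k) (s≤s a) (s≤s b) → gap k a b }) , rest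

-- The rightmost greedy matching cannot be moved further right to make room
-- for an additional first letter b.
squeeze : ∀ b e x → length e ≡ length x → (b ∷ nz e) ≼ nz x →
  (Σ ℕ λ p → (∀ k → k < p → e ! k ≡ 0) × e ! p ≡ 0 × b ≤ x ! p) ⊎ Violation (e !_) (x !_)
squeeze b (zero ∷ e) (zero ∷ x) eq r with squeeze b e x (suc-injective eq) r
... | inj₁ (p , none , rest) = inj₁ (suc p , (λ { zero _ → refl ; (suc k) (s≤s k<) → none k k< }) , rest)
... | inj₂ viol = inj₂ (violation-shift viol)
squeeze b (zero ∷ e) (suc a ∷ x) eq (take b≤ _) = inj₁ (0 , (λ _ ()) , refl , b≤)
squeeze b (zero ∷ e) (suc a ∷ x) eq (skip r) with squeeze b e x (suc-injective eq) r
... | inj₁ (p , none , rest) = inj₁ (suc p , (λ { zero _ → refl ; (suc k) (s≤s k<) → none k k< }) , rest)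
... | inj₂ viol = inj₂ (violation-shift viol)
squeeze b (suc c ∷ e) (a ∷ x) eq r with squeeze (suc c) e x (suc-injective eq) (drop-first a r)
  where
  drop-first : ∀ a → (b ∷ suc c ∷ nz e) ≼ nz (a ∷ x) → (suc c ∷ nz e) ≼ nz x
  drop-first zero r = ≼-tail r
  drop-first (suc a) (take _ r) = r
  drop-first (suc a) (skip r) = ≼-tail r
... | inj₁ (p , none , ep , c≤) = inj₂ (0 , suc p , s≤s z≤n , s≤s z≤n ,
  (λ { (suc k) _ (s≤s k<) → none k k< }) , ep , c≤)
... | inj₂ viol = inj₂ (violation-shift viol)

-- Up to `q` the letters of `e` fill `x` exactly. After lowering at `q` the letter there no longer
-- fits its place and has to move right, so `squeeze` finds either room for it or a violation
-- further on.
early-step-violation : ∀ e x q → length e ≡ length x → 1 ≤ x ! q → (∀ k → k ≤ q → e ! k ≡ x ! k) →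
  nz e ≼ nz (sub1 x q) → Violation (e !_) (x !_)
early-step-violation [] [] q _ () _ _
early-step-violation (c ∷ e) (a ∷ x) q eq 1≤ agree r with agree 0 z≤n
early-step-violation (c ∷ e) (suc a ∷ x) zero eq 1≤ agree r | refl
  with squeeze (suc a) e x (suc-injective eq) (drop-first a r)
  where
  drop-first : ∀ a → (suc a ∷ nz e) ≼ nz (a ∷ x) → (suc a ∷ nz e) ≼ nz x
  drop-first zero r = r
  drop-first (suc a) (take a< _) = contradiction a< (<-irrefl refl)
  drop-first (suc a) (skip r) = r
... | inj₁ (p , none , ep , a≤) = 0 , suc p , s≤s z≤n , s≤s z≤n ,
  (λ { (suc k) _ (s≤s k<) → none k k< }) , ep , a≤
... | inj₂ viol = violation-shift viol
early-step-violation (c ∷ e) (a ∷ x) (suc q) eq 1≤ agree r | refl = violation-shift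
  (early-step-violation e x q (suc-injective eq) 1≤ (λ k k≤ → agree (suc k) (s≤s k≤)) (drop-first a r))
  where
  drop-first : ∀ a → nz (a ∷ e) ≼ nz (a ∷ sub1 x q) → nz e ≼ nz (sub1 x q)
  drop-first zero r = r
  drop-first (suc a) (take _ r) = r
  drop-first (suc a) (skip r) = ≼-tail r

state-length : ∀ η ls k → length (state η ls k) ≡ length η
state-length η ls zero = refl
state-length η [] (suc k) = refl
state-length η (i ∷ ls) (suc k) = trans (state-length (sub1 η i) ls k) (sub1-length η i)

-- The letter sum acts as the rank, telling apart words at different times.
state-sum : ∀ η ls → Weak η ls → ∀ k → k ≤ length ls → sum (state η ls k) + k ≡ sum η
state-sum η ls _ zero _ = +-identityʳ (sum η)
state-sum η (i ∷ ls) (1≤ , wk) (suc k) (s≤s k≤) = trans (+-suc _ k)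
  (trans (cong suc (state-sum (sub1 η i) ls wk k k≤)) (sym (sum-sub1 η i 1≤)))

state-∈ : ∀ η ls k → k ≤ length ls → nz (state η ls k) ∈ (nz η ∷ words η ls)
state-∈ η ls zero _ = here refl
state-∈ η (i ∷ ls) (suc k) (s≤s k≤) = there (state-∈ (sub1 η i) ls k k≤)

state-chain : ∀ η ls → Weak η ls → ∀ j → j ≤ length ls → Σ (List Word) λ C →
  ChainTo (nz (run η ls)) (nz (state η ls j)) C ×
  (∀ k → k ≤ length ls → j ≤ k → nz (state η ls k) ∈ C)
state-chain η ls wk zero _ = _ , words-chain η ls wk , λ k k≤ _ → state-∈ η ls k k≤
state-chain η (i ∷ ls) (_ , wk) (suc j) (s≤s j≤) with state-chain (sub1 η i) ls wk j j≤
... | C , chain , mem = C , chain , λ { (suc k) (s≤s k≤) (s≤s j≤k) → mem k k≤ j≤k }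

state-constant : ∀ η ls p j → j ≤ length ls → (∀ k → k < j → ls ! k ≡ p) →
  state η ls j ≡ run η (replicate j p)
state-constant η ls p zero _ _ = refl
state-constant η (i ∷ ls) p (suc j) (s≤s j≤) all with all 0 (s≤s z≤n)
... | refl = state-constant (sub1 η i) ls p j j≤ (λ k k< → all (suc k) (s≤s k<))

labels-sum : ∀ {η ys ls e v} → Labels η ys ls e → v ∈ ys → sum v < sum η
labels-sum {η} (step {η' = η'} (_ , 1≤ , refl , refl , _) L) (here refl)
  rewrite sum-nz η' = ≤-reflexive (sym (sum-sub1 η _ 1≤))
labels-sum {η} (step (_ , 1≤ , refl , refl , _) L) (there v∈) =
  subst (_ <_) (sym (sum-sub1 η _ 1≤)) (m<n⇒m<1+n (labels-sum L v∈))

labels-≼ : ∀ {η ys ls e v} → Labels η ys ls e → v ∈ (nz η ∷ ys) → v ≼ nz η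
labels-≼ {η} _ (here refl) = ≼-refl (nz η)
labels-≼ {η} (step {i = i} (_ , _ , refl , refl , _) L) (there v∈) =
  ≼-trans (labels-≼ L v∈) (nz-sub1-≼ η i)

module _ {η i ls} {1≤ : 1 ≤ η ! i} {wk : Weak (sub1 η i) ls} where
  private
    module W = ChainWalk η (i ∷ ls) (1≤ , wk)
    module T = ChainWalk (sub1 η i) ls wk

  basic-tail : ∀ {s t} → W.Basic (suc s) (suc t) → T.Basic s t
  basic-tail (inj₁ (eq , t≤ , lt)) = inj₁ (suc-injective eq , s≤s⁻¹ t≤ , lt)
  basic-tail {s} (inj₂ (p , p' , F)) = inj₂ (p , p' , record
    { long = s≤s⁻¹ F.long
    ; inside = s≤s⁻¹ F.inside
    ; labels = λ k s≤k k<t → F.labels (suc k) (s≤s s≤k) (s≤s k<t)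
    ; emptied = F.emptied
    ; left = F.left
    ; gap = F.gap
    ; level = suc-injective (trans (sym (+-suc _ s)) F.level) })
    where module F = W.Flat F

  basic-cons : ∀ {s t} → T.Basic s t → W.Basic (suc s) (suc t)
  basic-cons (inj₁ (eq , t≤ , lt)) = inj₁ (cong suc eq , s≤s t≤ , lt)
  basic-cons {s} (inj₂ (p , p' , F)) = inj₂ (p , p' , record
    { long = s≤s F.long
    ; inside = s≤s F.inside
    ; labels = λ { (suc k) (s≤s s≤k) (s≤s k<t) → F.labels k s≤k k<t }
    ; emptied = F.emptied
    ; left = F.left
    ; gap = F.gap
    ; level = trans (+-suc _ s) (cong suc F.level) })
    where module F = T.Flat F

-- `Skipped` for chains starting at an arbitrary expansion, zeros allowed, so that induction can
-- strip the first label.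
Avoiding : Word → List ℕ → List ℕ → ℕ → ℕ → Set
Avoiding u η ls i j = Σ (List Word) λ ys → Σ (List ℕ) λ ls' → Σ (List ℕ) λ e →
  Labels η ys ls' e × ChainTo u (nz η) (nz η ∷ ys) × ls' <lex ls ×
  (∀ k → k ≤ length ls → k ≤ i ⊎ j ≤ k → nz (state η ls k) ∈ (nz η ∷ ys))

-- The detour begins with the smaller label `q`, reaches the word at time `j` by any path `ms`, and
-- then follows the given chain. The first label alone decides the lexicographic comparison.
avoid-by : ∀ η p ls j q ms → Valid η (p ∷ ls) → j ≤ suc (length ls) → 1 ≤ j → q < p → Ok η q →
  Weak (sub1 η q) ms → nz (run (sub1 η q) ms) ≡ nz (state η (p ∷ ls) j) →
  Avoiding (nz (run η (p ∷ ls))) η (p ∷ ls) 0 j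
avoid-by η p ls j q ms v j≤ 1≤j q<p ok wk eq
  with state-chain η (p ∷ ls) (valid⇒weak (p ∷ ls) v) j j≤
... | C , chain , mem
  with weak⇒chain (sub1 η q) ms wk (subst (λ y → ChainTo _ y C) (sym eq) chain)
... | C' , chain' , sub with chain⇒labels (sub1 η q) chain' refl
... | ls' , v' , refl , u≡ = words η (q ∷ ls') , q ∷ ls' , run η (q ∷ ls') ,
  valid⇒labels η (q ∷ ls') (ok , v') , cons (nz-sub1-decr η q (proj₁ ok)) chain' , this q<p , included
  where
  included : ∀ k → k ≤ suc (length ls) → k ≤ 0 ⊎ j ≤ k → nz (state η (p ∷ ls) k) ∈ (nz η ∷ words η (q ∷ ls'))
  included zero _ _ = here refl
  included k@(suc _) k≤ (inj₂ j≤k) = there (sub (mem k k≤ j≤k))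

basic⇒avoiding : ∀ η ls i j (v : Valid η ls) → ChainWalk.Basic η ls (valid⇒weak ls v) i j →
  Avoiding (nz (run η ls)) η ls i j
basic⇒avoiding η (p ∷ q ∷ ls) zero j v@(okp , okq , _) (inj₁ (refl , j≤ , q<p)) =
  avoid-by η p (q ∷ ls) 2 q (p ∷ []) v j≤ (s≤s z≤n) q<p okη
    (subst (1 ≤_) (sym (sub1-off η q p p≢q)) (proj₁ okp) , tt)
    (cong nz (sub1-comm η q p))
  where
  p≢q : p ≢ q
  p≢q eq = <⇒≢ q<p (sym eq)
  same : ∀ k → k ≤ q → sub1 η p ! k ≡ η ! k
  same k k≤q = sub1-off η p k (λ eq → <⇒≢ (≤-<-trans k≤q q<p) eq)
  -- Lowering at `p` changes nothing at or to the left of `q`, so `q` is as legitimate before that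
  -- step as after it.
  okη : Ok η q
  okη = subst (1 ≤_) (same q ≤-refl) (proj₁ okq) , λ { one (k , k<q , ηk , gap) →
    proj₂ okq (trans (same q ≤-refl) one) (k , k<q , trans (same k (<⇒≤ k<q)) ηk ,
      λ m k<m m<q → trans (same m (<⇒≤ m<q)) (gap m k<m m<q)) }
basic⇒avoiding η (p₀ ∷ ls) zero (suc j) v (inj₂ (p , p' , F))
  with ChainWalk.Flat.labels F 0 z≤n (s≤s z≤n)
-- All `suc j` steps are made at `p'` instead of `p`. Both entries equal `suc j` with only zeros
-- between them, so the resulting word is the same; and since the entry is at least 2, the first
-- step erases no 1.
... | refl = avoid-by η p ls (suc j) p' (replicate j p') v F.inside (s≤s z≤n) F.left
    (≤-trans (s≤s z≤n) 2≤ , λ one → contradiction (subst (2 ≤_) one 2≤) λ { (s≤s ()) })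
    (proj₂ (weak-replicate η (suc j) p' (≤-reflexive (sym level))))
    (trans (cong nz (run-zeroAt η p' level)) (trans
      (nz-zeroAt η p' p F.left (subst (1 ≤_) (sym start) (s≤s z≤n)) (trans level (sym start)) F.gap)
      (sym (cong nz (trans (state-constant η (p ∷ ls) p (suc j) F.inside (λ k → F.labels k z≤n))
        (run-zeroAt η p start))))))
  where
  module W = ChainWalk η (p ∷ ls) (valid⇒weak (p ∷ ls) v)
  module F = W.Flat F
  2≤ : 2 ≤ η ! p'
  2≤ = W.level-positive F
  level : η ! p' ≡ suc j
  level = trans (sym (+-identityʳ _)) F.level
  start : η ! p ≡ suc j
  start = trans (sym (+-identityʳ _)) F.start
basic⇒avoiding η (_ ∷ []) zero (suc j) v (inj₁ (refl , s≤s () , _))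
basic⇒avoiding η [] i j v b = contradiction
  (≤-trans (ChainWalk.basic-long η [] tt b) (ChainWalk.basic-inside η [] tt b)) λ ()
basic⇒avoiding η (_ ∷ _) i zero v b = contradiction (ChainWalk.basic-long η _ (valid⇒weak _ v) b) λ ()
basic⇒avoiding η (p ∷ ls) (suc i) (suc j) v@((1≤ , lm) , v') b
  with basic⇒avoiding (sub1 η p) ls i j v' (basic-tail b)
... | ys , ls' , e , L , chain , lex , mem =
  nz (sub1 η p) ∷ ys , p ∷ ls' , e , step (!-bound η p 1≤ , 1≤ , refl , refl , lm) L ,
  cons (nz-sub1-decr η p 1≤) chain , next lex , included
  where
  included : ∀ k → k ≤ suc (length ls) → k ≤ suc i ⊎ suc j ≤ k →
    nz (state η (p ∷ ls) k) ∈ (nz η ∷ nz (sub1 η p) ∷ ys)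
  included zero _ _ = here refl
  included (suc k) (s≤s k≤) (inj₁ (s≤s k≤i)) = there (mem k k≤ (inj₁ k≤i))
  included (suc k) (s≤s k≤) (inj₂ (s≤s j≤k)) = there (mem k k≤ (inj₂ j≤k))

-- By rank, a word at a positive time cannot be the head of the chain.
∈-later : ∀ {η ls ys} → Weak η ls → ∀ k → suc k ≤ length ls →
  nz (state η ls (suc k)) ∈ (nz η ∷ ys) → nz (state η ls (suc k)) ∈ ys
∈-later wk k k< (there v∈) = v∈
∈-later {η} {ls} wk k k< (here eq) = contradiction
  (trans (sym (state-sum η ls wk (suc k) k<))
    (trans (+-suc _ k) (cong (λ s → suc (s + k))
      (trans (sym (sum-nz (state η ls (suc k)))) (trans (cong sum eq) (sum-nz η))))))
  (<⇒≢ (s≤s (m≤m+n (sum η) k)))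

-- The word after `p` differs from the word after `q` by `step-unique`, and from all later ones by
-- rank.
step-differs : ∀ {η p q ys ls' e} → Ok η p → Ok η q → q < p → Labels (sub1 η q) ys ls' e →
  nz (sub1 η p) ∈ (nz (sub1 η q) ∷ ys) → ⊥
step-differs {η} {p} {q} okp okq q<p L (here eq) =
  <⇒≢ q<p (sym (step-unique η p q okp okq eq))
step-differs {η} {p} {q} okp okq q<p L (there v∈) =
  <-irrefl (suc-injective (trans (sym (sum-sub1 η p (proj₁ okp))) (sum-sub1 η q (proj₁ okq))))
    (subst (_< sum (sub1 η q)) (sum-nz (sub1 η p)) (labels-sum L v∈))

-- Without a descent before `j` the labels ascend from `p`, so positions up to `q` are untouched at
-- time `j`; the early step then yields a violation and hence a flat block.
early-step⇒basic : ∀ η p ls j q (v : Valid η (p ∷ ls)) → j ≤ suc (length ls) → 1 ≤ η ! q → q < p →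
  nz (state η (p ∷ ls) j) ≼ nz (sub1 η q) →
  Σ ℕ λ i' → Σ ℕ λ j' → ChainWalk.Basic η (p ∷ ls) (valid⇒weak (p ∷ ls) v) i' j' × j' ≤ j
early-step⇒basic η p ls j q v j≤ 1≤ q<p below = [ descent , ascending ]′ (W.descent-or-ascending j)
  where
  module W = ChainWalk η (p ∷ ls) (valid⇒weak (p ∷ ls) v)
  Result = Σ ℕ λ i' → Σ ℕ λ j' → W.Basic i' j' × j' ≤ j
  descent : (Σ ℕ λ k → suc k < j × (p ∷ ls) ! suc k < (p ∷ ls) ! k) → Result
  descent (k , k< , lt) = k , 2 + k , inj₁ (refl , ≤-trans k< j≤ , lt) , k<
  ascending : W.Ascending j → Result
  ascending asc = W.violation⇒basic (leftmost η (p ∷ ls) v) j j≤ asc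
    (early-step-violation (state η (p ∷ ls) j) η q (state-length η (p ∷ ls) j) 1≤
      (λ k k≤q → W.fixed k z≤n j≤
        (λ m _ m< eq → <⇒≱ (≤-<-trans k≤q q<p) (subst (p ≤_) eq (asc z≤n m<))))
      below)

-- Common labels are stripped. Where the chains part, the next word of the given chain must lie
-- inside the interval, by `step-differs`, and the word at time `j` lies below the smaller step.
avoiding⇒basic : ∀ {η ys ls' e} ls i j (v : Valid η ls) → j ≤ length ls → Labels η ys ls' e →
  ls' <lex ls → (∀ k → k ≤ length ls → k ≤ i ⊎ j ≤ k → nz (state η ls k) ∈ (nz η ∷ ys)) →
  Σ ℕ λ i' → Σ ℕ λ j' → ChainWalk.Basic η ls (valid⇒weak ls v) i' j' × i ≤ i' × j' ≤ j
avoiding⇒basic (p ∷ ls) i j v j≤ done halt mem =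
  contradiction (∈-later (valid⇒weak (p ∷ ls) v) (length ls) ≤-refl (mem _ ≤-refl (inj₂ j≤))) λ ()
avoiding⇒basic (p ∷ ls) (suc i) j v j≤ (step (_ , 1≤ , refl , refl , lm) L) (this q<p) mem =
  ⊥-elim (step-differs (proj₁ v) (1≤ , lm) q<p L
    (∈-later (valid⇒weak (p ∷ ls) v) 0 (s≤s z≤n) (mem 1 (s≤s z≤n) (inj₁ (s≤s z≤n)))))
avoiding⇒basic (p ∷ ls) zero zero v j≤ (step (_ , 1≤ , refl , refl , lm) L) (this q<p) mem =
  ⊥-elim (step-differs (proj₁ v) (1≤ , lm) q<p L
    (∈-later (valid⇒weak (p ∷ ls) v) 0 (s≤s z≤n) (mem 1 (s≤s z≤n) (inj₂ z≤n))))
avoiding⇒basic {η} (p ∷ ls) zero (suc j) v j≤ (step {i = q} (_ , 1≤ , refl , refl , _) L) (this q<p) mem =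
  let i' , j' , b , j'≤ = early-step⇒basic η p ls (suc j) q v j≤ 1≤ q<p
        (labels-≼ L (∈-later (valid⇒weak (p ∷ ls) v) j j≤ (mem (suc j) j≤ (inj₂ ≤-refl))))
  in i' , j' , b , z≤n , j'≤
avoiding⇒basic {η} (p ∷ ls) i j v j≤ (step {ys = ys} (_ , _ , refl , refl , _) L) (next lex) mem =
  -- After a common step the tails share their first word, so `pred` is safe also when `i` is 0.
  let i' , j' , b , i≤ , j'≤ = avoiding⇒basic ls (pred i) (pred j) (proj₂ v) (pred-mono-≤ j≤) L lex included
  in suc i' , suc j' , basic-cons b , pred≤⇒≤suc i i≤ ,
     lower j (≤-trans (s≤s z≤n) (ChainWalk.basic-long (sub1 η p) ls _ b)) j'≤
  where
  lift : ∀ {k} i j → suc k ≤ pred i ⊎ pred j ≤ suc k → 2 + k ≤ i ⊎ j ≤ 2 + k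
  lift (suc i) j (inj₁ k<) = inj₁ (s≤s k<)
  lift i zero (inj₂ _) = inj₂ z≤n
  lift i (suc j) (inj₂ ≤k) = inj₂ (s≤s ≤k)
  included : ∀ k → k ≤ length ls → k ≤ pred i ⊎ pred j ≤ k →
    nz (state (sub1 η p) ls k) ∈ (nz (sub1 η p) ∷ ys)
  included zero _ _ = here refl
  included (suc k) k≤ side =
    ∈-later (valid⇒weak (p ∷ ls) v) (suc k) (s≤s k≤) (mem (2 + k) (s≤s k≤) (lift i j side))
  pred≤⇒≤suc : ∀ {i'} i → pred i ≤ i' → i ≤ suc i'
  pred≤⇒≤suc zero _ = z≤n
  pred≤⇒≤suc (suc i) i≤ = s≤s i≤
  lower : ∀ {j'} j → 1 ≤ j' → j' ≤ pred j → suc j' ≤ j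
  lower zero (s≤s _) ()
  lower (suc j) _ j'≤ = s≤s j'≤

-- Disjoint intervals

-- The auxiliary function of interval is not in scope; it is captured by
-- abstracting over its arguments.
interval-enumerates : ∀ i j → Σ (ℕ → ℕ → List ℕ) λ g →
  interval (i , j) ≡ g (suc i) (j ∸ suc i) ×
  (∀ a → g a 0 ≡ []) × (∀ a n → g a (suc n) ≡ a ∷ g (suc a) n)
interval-enumerates i j = g , captured , (λ _ → refl) , (λ _ _ → refl)
  where
  g : ℕ → ℕ → List ℕ
  g = _
  captured : interval (i , j) ≡ g (suc i) (j ∸ suc i)
  captured with suc i | j ∸ suc i
  ... | a | n = refl

interval⁻ : ∀ {i j k} → k ∈ interval (i , j) → i < k × k < j
interval⁻ {i} {j} {k} k∈ with interval-enumerates i j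
... | g , eq , g-zero , g-suc = let i<k , k< = bounds (suc i) (j ∸ suc i) (subst (k ∈_) eq k∈) in
  i<k , ≤∸⇒< i<k k<
  where
  bounds : ∀ a n → k ∈ g a n → a ≤ k × k < a + n
  bounds a zero k∈ = contradiction (subst (k ∈_) (g-zero a) k∈) λ ()
  bounds a (suc n) k∈ with subst (k ∈_) (g-suc a n) k∈
  ... | here refl = ≤-refl , m<m+n a (s≤s z≤n)
  ... | there k∈' = let a<k , k< = bounds (suc a) n k∈' in
    <⇒≤ a<k , subst (k <_) (sym (+-suc a n)) k<
  ≤∸⇒< : i < k → k < suc i + (j ∸ suc i) → k < j
  ≤∸⇒< i<k k< with suc i ≤? j
  ... | yes i<j = subst (k <_) (m+[n∸m]≡n i<j) k<
  ... | no i≮j rewrite m≤n⇒m∸n≡0 (≰⇒≥ i≮j) | +-identityʳ i = contradiction i<k (<⇒≱ k<)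

interval⁺ : ∀ {i j k} → i < k → k < j → k ∈ interval (i , j)
interval⁺ {i} {j} {k} i<k k<j with interval-enumerates i j
... | g , eq , g-zero , g-suc = subst (k ∈_) (sym eq) (inside (suc i) (j ∸ suc i) i<k
  (subst (k <_) (sym (m+[n∸m]≡n (≤-trans i<k (<⇒≤ k<j)))) k<j))
  where
  inside : ∀ a n → a ≤ k → k < a + n → k ∈ g a n
  inside a zero a≤k k< = contradiction (subst (k <_) (+-identityʳ a) k<) (≤⇒≯ a≤k)
  inside a (suc n) a≤k k< = subst (k ∈_) (sym (g-suc a n)) (first-or-rest (m≤n⇒m<n∨m≡n a≤k))
    where
    first-or-rest : a < k ⊎ a ≡ k → k ∈ (a ∷ g (suc a) n)
    first-or-rest (inj₁ a<k) = there (inside (suc a) n a<k (subst (k <_) (+-suc a n) k<))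
    first-or-rest (inj₂ refl) = here refl

memb⁻ : ∀ k A → memb k A ≡ true → k ∈ A
memb⁻ k (a ∷ A) eq with k ≡ᵇ a in same
... | true = here (≡ᵇ⇒≡ k a (Equivalence.from T-≡ same))
... | false = there (memb⁻ k A eq)

memb⁺ : ∀ {k A} → k ∈ A → memb k A ≡ true
memb⁺ {k} (here refl) rewrite Equivalence.to T-≡ (≡⇒≡ᵇ k k refl) = refl
memb⁺ {k} {a ∷ A} (there k∈) with k ≡ᵇ a
... | true = refl
... | false = memb⁺ k∈

subsetB⁺ : ∀ {A B} → (∀ {k} → k ∈ A → k ∈ B) → subsetB A B ≡ true
subsetB⁺ {[]} _ = refl
subsetB⁺ {a ∷ A} ⊆ rewrite memb⁺ (⊆ (here refl)) = subsetB⁺ (⊆ ∘ there)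

Disjoint : List ℕ → List ℕ → Set
Disjoint A B = ∀ k → k ∈ A → k ∈ B → ⊥

Inhabited : List ℕ → Set
Inhabited A = Σ ℕ (_∈ A)

filterᵇ-all : ∀ {X : Set} (p : X → Bool) {L} → All (λ A → p A ≡ true) L → filterᵇ p L ≡ L
filterᵇ-all p [] = refl
filterᵇ-all p (eq ∷ eqs) rewrite eq = cong (_ ∷_) (filterᵇ-all p eqs)

strictSupB-refl : ∀ A → strictSupB A A ≡ false
strictSupB-refl A rewrite subsetB⁺ {A} id = refl

strictSupB-disjoint : ∀ {A B} → Disjoint A B → Inhabited B → strictSupB A B ≡ false
strictSupB-disjoint {A} {b ∷ B} disj _ with memb b A in eq
... | true = ⊥-elim (disj b (memb⁻ b A eq) (here refl))
... | false = refl

anyB-false : ∀ {X : Set} (p : X → Bool) {L} → All (λ A → p A ≡ false) L → anyB p L ≡ false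
anyB-false p [] = refl
anyB-false p (eq ∷ eqs) rewrite eq = anyB-false p eqs

pairwise : ∀ {L} → AllPairs Disjoint L → ∀ {A B} → A ∈ L → B ∈ L → A ≡ B ⊎ Disjoint A B
pairwise _ (here refl) (here refl) = inj₁ refl
pairwise (disj ∷ _) (here refl) (there B∈) = inj₂ (All.lookup disj B∈)
pairwise (disj ∷ _) (there A∈) (here refl) = inj₂ λ k a b → All.lookup disj A∈ k b a
pairwise (_ ∷ disjs) (there A∈) (there B∈) = pairwise disjs A∈ B∈

prune-separated : ∀ {L} → All Inhabited L → AllPairs Disjoint L → prune L ≡ L
prune-separated {L} inhab disj = prune-fixed L
  (filterᵇ-all _ (All.map (λ { {_ ∷ _} _ → refl ; {[]} (_ , ()) }) inhab))
  (filterᵇ-all _ (All.tabulate λ {A} A∈ → cong not (anyB-false (strictSupB A)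
    (All.tabulate λ B∈ → [ (λ { refl → strictSupB-refl A })
                         , (λ d → strictSupB-disjoint d (All.lookup inhab B∈)) ]′
                         (pairwise disj A∈ B∈)))))
  where
  -- Naming the intermediate list lets the two filters of `prune` be evaluated one after the other.
  prune-fixed : ∀ L' → filterᵇ (λ A → not (null A)) L ≡ L' →
    filterᵇ (λ A → not (anyB (strictSupB A) L')) L' ≡ L' → prune L ≡ L'
  prune-fixed _ refl eq = eq

minus-disjoint : ∀ {A J} → Disjoint J A → minus A J ≡ A
minus-disjoint {A} {J} disj = filterᵇ-all _ (All.tabulate λ {k} k∈ → cong not (not-memb k k∈))
  where
  not-memb : ∀ k → k ∈ A → memb k J ≡ false
  not-memb k k∈ with memb k J in eq
  ... | true = ⊥-elim (disj k (memb⁻ k J eq) k∈)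
  ... | false = refl

-- On nonempty pairwise disjoint sets neither taking differences nor pruning has any effect, so the
-- sets are picked in the given order.
jseqF-separated : ∀ L → All Inhabited L → AllPairs Disjoint L → jseqF (length L) L ≡ L
jseqF-separated [] _ _ = refl
jseqF-separated (J ∷ L) (_ ∷ inhab) (disj ∷ disjs) = cong (J ∷_) (trans
  (cong (jseqF (length L)) (trans (cong prune (map-id-local (All.map minus-disjoint disj)))
    (prune-separated inhab disjs)))
  (jseqF-separated L inhab disjs))

-- Each head has the least first component of its list, so the heads agree and can be removed.
sorted-unique : ∀ {xs ys : List (ℕ × ℕ)} →
  AllPairs (λ a b → proj₁ a < proj₁ b) xs → AllPairs (λ a b → proj₁ a < proj₁ b) ys →
  (∀ {z} → z ∈ xs → z ∈ ys) → (∀ {z} → z ∈ ys → z ∈ xs) → xs ≡ ys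
sorted-unique {[]} {[]} _ _ _ _ = refl
sorted-unique {[]} {_ ∷ _} _ _ _ back = contradiction (back (here refl)) λ ()
sorted-unique {_ ∷ _} {[]} _ _ to _ = contradiction (to (here refl)) λ ()
sorted-unique {x ∷ xs} {y ∷ ys} (x< ∷ sx) (y< ∷ sy) to back = aligned same to back
  where
  same : x ≡ y
  same with to (here refl) | back (here refl)
  ... | here eq | _ = eq
  ... | there _ | here eq = sym eq
  ... | there x∈ | there y∈ = contradiction (All.lookup y< x∈) (<-asym (All.lookup x< y∈))
  strip : ∀ {v : ℕ × ℕ} {as bs} → All (λ b → proj₁ v < proj₁ b) as →
    (∀ {z} → z ∈ (v ∷ as) → z ∈ (v ∷ bs)) → ∀ {z} → z ∈ as → z ∈ bs
  strip v< sub z∈ with sub (there z∈)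
  ... | here refl = contradiction (All.lookup v< z∈) (<-irrefl refl)
  ... | there z∈' = z∈'
  aligned : x ≡ y → (∀ {z} → z ∈ (x ∷ xs) → z ∈ (y ∷ ys)) → (∀ {z} → z ∈ (y ∷ ys) → z ∈ (x ∷ xs)) →
    x ∷ xs ≡ y ∷ ys
  aligned refl to back = cong (x ∷_) (sorted-unique sx sy (strip x< to) (strip y< back))

-- Weakly decreasing label sequences

-- The weakly decreasing label sequence from the word to the embedding: positions further right are
-- lowered first.
canonical : List ℕ → List ℕ → List ℕ
canonical (a ∷ w) (e ∷ η) = map suc (canonical w η) ++ replicate (a ∸ e) 0
canonical _ _ = []

run-map-suc : ∀ a x ls r → run (a ∷ x) (map suc ls ++ r) ≡ run (a ∷ run x ls) r
run-map-suc a x [] r = refl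
run-map-suc a x (i ∷ ls) r = run-map-suc a (sub1 x i) ls r

weak-map-suc⁺ : ∀ a x ls r → Weak x ls → Weak (a ∷ run x ls) r → Weak (a ∷ x) (map suc ls ++ r)
weak-map-suc⁺ a x [] r _ wk = wk
weak-map-suc⁺ a x (i ∷ ls) r (1≤ , wk) wk' = 1≤ , weak-map-suc⁺ a (sub1 x i) ls r wk wk'

weak-map-suc⁻ : ∀ a x ls r → Weak (a ∷ x) (map suc ls ++ r) → Weak x ls × Weak (a ∷ run x ls) r
weak-map-suc⁻ a x [] r wk = tt , wk
weak-map-suc⁻ a x (i ∷ ls) r (1≤ , wk) =
  let wk₁ , wk₂ = weak-map-suc⁻ a (sub1 x i) ls r wk in (1≤ , wk₁) , wk₂

weak-replicate⁻ : ∀ a x m → Weak (a ∷ x) (replicate m 0) → m ≤ a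
weak-replicate⁻ a x zero _ = z≤n
weak-replicate⁻ (suc a) x (suc m) (_ , wk) = s≤s (weak-replicate⁻ a x m wk)

canonical-run : ∀ w η → length η ≡ length w → (∀ i → i < length w → η ! i ≤ w ! i) →
  run w (canonical w η) ≡ η
canonical-run [] [] _ _ = refl
canonical-run (a ∷ w) (e ∷ η) eq below = trans (run-map-suc a w (canonical w η) _)
  (trans (run-replicate-zero a _ (a ∸ e)) (cong₂ _∷_ (m∸[m∸n]≡n (below 0 (s≤s z≤n)))
    (canonical-run w η (suc-injective eq) (λ i i< → below (suc i) (s≤s i<)))))

canonical-weak : ∀ w η → Weak w (canonical w η)
canonical-weak [] _ = tt
canonical-weak (a ∷ w) [] = tt
canonical-weak (a ∷ w) (e ∷ η) = weak-map-suc⁺ a w (canonical w η) _ (canonical-weak w η)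
  (weak-replicate _ (a ∸ e) 0 (m∸n≤m a e))

canonical-descending : ∀ w η → AllPairs (flip _≤_) (canonical w η)
canonical-descending [] _ = []
canonical-descending (a ∷ w) [] = []
canonical-descending (a ∷ w) (e ∷ η) =
  AllPairs.++⁺ (AllPairs.map⁺ (shift (canonical-descending w η))) (zeros (a ∸ e))
    (All.tabulate λ _ → All.replicate⁺ (a ∸ e) z≤n)
  where
  shift : ∀ {ls} → AllPairs (flip _≤_) ls → AllPairs (λ a b → suc b ≤ suc a) ls
  shift [] = []
  shift (as ∷ ps) = All.map s≤s as ∷ shift ps
  zeros : ∀ n → AllPairs (flip _≤_) (replicate n 0)
  zeros zero = []
  zeros (suc n) = All.replicate⁺ n z≤n ∷ zeros n

-- Brings a weakly decreasing sequence into the shape of `canonical`: once a 0 occurs, only zeros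
-- follow.
split-zeros : ∀ ls → AllPairs (flip _≤_) ls → Σ (List ℕ) λ ls₁ → Σ ℕ λ m →
  ls ≡ map suc ls₁ ++ replicate m 0 × AllPairs (flip _≤_) ls₁
split-zeros [] _ = [] , 0 , refl , []
split-zeros (zero ∷ ls) (all ∷ _) = [] , suc (length ls) , cong (0 ∷_) (zeros all) , []
  where
  zeros : ∀ {ls} → All (_≤ 0) ls → ls ≡ replicate (length ls) 0
  zeros [] = refl
  zeros (z≤n ∷ as) = cong (0 ∷_) (zeros as)
split-zeros (suc i ∷ ls) (all ∷ ps) with split-zeros ls ps
... | ls₁ , m , refl , ps₁ = i ∷ ls₁ , m , refl ,
  All.map s≤s⁻¹ (All.map⁻ (All.++⁻ˡ (map suc ls₁) all)) ∷ ps₁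

canonical-unique : ∀ w ls → AllPairs (flip _≤_) ls → Weak w ls → ls ≡ canonical w (run w ls)
canonical-unique [] [] _ _ = refl
canonical-unique [] (_ ∷ _) _ (() , _)
canonical-unique (a ∷ w) ls ps wk with split-zeros ls ps
... | ls₁ , m , refl , ps₁ with weak-map-suc⁻ a w ls₁ (replicate m 0) wk
... | wk₁ , wk₂
  -- Weakness bounds `m` by `a`, so the truncated difference returns `m` itself.
  rewrite run-map-suc a w ls₁ (replicate m 0) | run-replicate-zero a (run w ls₁) m
        | m∸[m∸n]≡n (weak-replicate⁻ a (run w ls₁) m wk₂) =
  cong (λ x → map suc x ++ replicate m 0) (canonical-unique w ls₁ ps₁ wk₁)

decreasing⇒pairs : ∀ {ls} → WeaklyDecreasing ls → AllPairs (flip _≤_) ls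
decreasing⇒pairs = Linked⇒AllPairs (λ a b → ≤-trans b a)

pairs⇒index : ∀ {ls} → AllPairs (flip _≤_) ls → ∀ {k m} → k ≤ m → m < length ls → ls ! m ≤ ls ! k
pairs⇒index {i ∷ ls} _ {zero} {zero} _ _ = ≤-refl
pairs⇒index {i ∷ ls} (all ∷ _) {zero} {suc m} _ (s≤s m<) = at all m<
  where
  at : ∀ {ls m} → All (_≤ i) ls → m < length ls → ls ! m ≤ i
  at {m = zero} (b ∷ _) _ = b
  at {m = suc m} (_ ∷ bs) (s≤s m<) = at bs m<
pairs⇒index {i ∷ ls} (_ ∷ ps) (s≤s k≤m) (s≤s m<) = pairs⇒index ps k≤m m<

adjacent⇒decreasing : ∀ ls → (∀ k → suc k < length ls → ls ! suc k ≤ ls ! k) → WeaklyDecreasing ls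
adjacent⇒decreasing [] _ = []
adjacent⇒decreasing (_ ∷ []) _ = [-]
adjacent⇒decreasing (_ ∷ j ∷ ls) adj =
  adj 0 (s≤s (s≤s z≤n)) ∷ adjacent⇒decreasing (j ∷ ls) (λ k k< → adj (suc k) (s≤s k<))

-- Counting defects.

-- Truncation at 2 gives every erased letter of at least 2 the same weight; an erased 1 is counted
-- as a defect.
letter-cost : ∀ e a → e ≡ a ⊎ suc e ≡ a ⊎ e ≡ 0 → (a ∸ e) ⊓ 2 ≡
  (if suc e ≡ᵇ a then 1 else 0) + 2 * (if (e ≡ᵇ 0) ∧ (2 ≤ᵇ a) then 1 else 0)
letter-cost zero _ (inj₁ refl) = refl
letter-cost (suc e) _ (inj₁ refl) = kept e
  where
  kept : ∀ e → (e ∸ e) ⊓ 2 ≡ (if suc e ≡ᵇ e then 1 else 0) + 0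
  kept zero = refl
  kept (suc e) = kept e
letter-cost zero _ (inj₂ (inj₁ refl)) = refl
letter-cost (suc e) _ (inj₂ (inj₁ refl)) = lowered e
  where
  lowered : ∀ e → (suc e ∸ e) ⊓ 2 ≡ (if e ≡ᵇ e then 1 else 0) + 0
  lowered zero = refl
  lowered (suc e) = lowered e
letter-cost _ zero (inj₂ (inj₂ refl)) = refl
letter-cost _ (suc zero) (inj₂ (inj₂ refl)) = refl
letter-cost _ (suc (suc a)) (inj₂ (inj₂ refl)) = cong (2 +_) (⊓-zeroʳ a)

cost-defects : ∀ η w → length η ≡ length w →
  (∀ i → i < length w → η ! i ≡ w ! i ⊎ suc (η ! i) ≡ w ! i ⊎ η ! i ≡ 0) →
  cost (length w) (w !_) (η !_) ≡ defect η w + 2 * Defect0 η w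
cost-defects [] [] _ _ = refl
cost-defects (e ∷ η) (a ∷ w) eq near = trans
  (cong₂ _+_ (letter-cost e a (near 0 (s≤s z≤n)))
    (cost-defects η w (suc-injective eq) (λ i i< → near (suc i) (s≤s i<))))
  (regroup (if suc e ≡ᵇ a then 1 else 0) (if (e ≡ᵇ 0) ∧ (2 ≤ᵇ a) then 1 else 0) (defect η w) (Defect0 η w))
  where
  regroup : ∀ x y z t → x + 2 * y + (z + 2 * t) ≡ x + z + 2 * (y + t)
  regroup = solve-∀

-- Minimal skipped intervals and criticality of a labelled chain.

weak⇒valid : ∀ η ls → Weak η ls →
  (∀ k → k < length ls → state η ls k ! (ls ! k) ≡ 1 → ¬ LeftOne (state η ls k !_) (ls ! k)) →
  Valid η ls
weak⇒valid η [] _ _ = tt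
weak⇒valid η (i ∷ ls) (1≤ , wk) lm =
  (1≤ , lm 0 (s≤s z≤n)) , weak⇒valid (sub1 η i) ls wk (λ k k< → lm (suc k) (s≤s k<))

!-pos : ∀ {w} → Pos w → ∀ q → q < length w → 1 ≤ w ! q
!-pos (1≤ ∷ _) zero _ = 1≤
!-pos (_ ∷ ps) (suc q) (s≤s q<) = !-pos ps q q<

lookup-state : ∀ {x} η ls → x ≡ nz η → (k : Fin (length (x ∷ words η ls))) →
  lookup (x ∷ words η ls) k ≡ nz (state η ls (toℕ k))
lookup-state η ls eq zero = eq
lookup-state η (i ∷ ls) eq (suc k) = lookup-state (sub1 η i) ls refl k

chain-head : ∀ {u x C} → ChainTo u x C → Σ (List Word) λ ys → C ≡ x ∷ ys
chain-head single = [] , refl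
chain-head (cons _ _) = _ , refl

maxchain⇒labels : ∀ {u w C} → Pos w → MaxChain u w C →
  Σ (List ℕ) λ ls → Valid w ls × C ≡ w ∷ words w ls × u ≡ nz (run w ls)
maxchain⇒labels {u} {w} {C} pos chain =
  map₂ (map₂ λ { (C≡ , u≡) → subst (λ x → C ≡ x ∷ words w _) (nz-pos pos) C≡ , u≡ })
    (chain⇒labels w chain (sym (nz-pos pos)))

module Labelled (w : Word) (pos : Pos w) (ls : List ℕ) (v : Valid w ls) where
  open ChainWalk w ls (valid⇒weak ls v)

  u : Word
  u = nz (run w ls)

  C : List Word
  C = w ∷ words w ls

  maximal : MaxChain u w C
  maximal = subst (λ x → ChainTo u x (x ∷ words w ls)) (nz-pos pos) (words-chain w ls (valid⇒weak ls v))

  -- `_<ch_` only asks for some labelings; this pins the one of `C` to `ls`.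
  labeling-unique : ∀ {ls' e} → Labeling C ls' e → ls' ≡ ls × e ≡ run w ls
  labeling-unique {ls'} L with labels⇒valid L
  ... | v' , words≡ , refl with words-injective w ls ls' v v' words≡
  ... | refl = refl , refl

  skipped⇒basic : ∀ {i j} → Skipped u w C i j → Σ ℕ λ i' → Σ ℕ λ j' → Basic i' j' × i ≤ i' × j' ≤ j
  skipped⇒basic {i} {j} (_ , j≤ , C' , chain , (ls' , ls₂ , e' , e₂ , L' , L , lex) , mem)
    with refl , refl ← labeling-unique L
    with ys , refl ← chain-head chain =
    avoiding⇒basic ls i j v (subst (j ≤_) (words-length w ls) j≤) L' lex included
    where
    included : ∀ k → k ≤ length ls → k ≤ i ⊎ j ≤ k → nz (state w ls k) ∈ (nz w ∷ ys)
    included k k≤ side = subst (λ x → nz (state w ls k) ∈ (x ∷ ys)) (sym (nz-pos pos))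
      (subst (_∈ (w ∷ ys)) (trans (lookup-state w ls (sym (nz-pos pos)) position)
        (cong (λ m → nz (state w ls m)) position≡))
        (mem position (subst (λ m → m ≤ i ⊎ j ≤ m) (sym position≡) side)))
      where
      k< : k < suc (length (words w ls))
      k< = s≤s (subst (k ≤_) (sym (words-length w ls)) k≤)
      position : Fin (length C)
      position = fromℕ< k<
      position≡ : toℕ position ≡ k
      position≡ = toℕ-fromℕ< k<

  basic⇒skipped : ∀ {i j} → Basic i j → Skipped u w C i j
  basic⇒skipped {i} {j} b with basic⇒avoiding w ls i j v b
  ... | ys , ls' , e , L , chain , lex , mem =
    basic-long b , subst (j ≤_) (sym (words-length w ls)) (basic-inside b) ,
    w ∷ ys , subst (λ x → ChainTo u x (x ∷ ys)) (nz-pos pos) chain ,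
    (ls' , ls , e , run w ls , L , valid⇒labels w ls v , lex) ,
    λ k side → subst (λ x → lookup C k ∈ (x ∷ ys)) (nz-pos pos)
      (subst (_∈ (nz w ∷ ys)) (sym (lookup-state w ls (sym (nz-pos pos)) k))
        (mem (toℕ k) (subst (toℕ k ≤_) (words-length w ls) (s≤s⁻¹ (toℕ<n k))) side))

  -- A skipped interval inside a basic one contains a basic interval in turn. The two basic
  -- intervals share an interior time, hence coincide, and the interval between them is the same.
  basic⇒msi : ∀ {i j} → Basic i j → MSI u w C i j
  basic⇒msi {i} {j} b = basic⇒skipped b , minimal
    where
    minimal : ∀ k m → Skipped u w C k m → i ≤ k → m ≤ j → k ≡ i × m ≡ j
    minimal k m sk i≤k m≤j with skipped⇒basic sk
    ... | k' , m' , b' , k≤k' , m'≤m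
      with refl , refl ← basic-overlap b b' (s≤s (≤-trans i≤k k≤k'))
             (≤-trans (basic-long b') (≤-trans m'≤m m≤j)) ≤-refl (basic-long b') =
      ≤-antisym k≤k' i≤k , ≤-antisym m≤j m'≤m

  -- The basic interval inside is itself skipped, so minimality makes it the whole.
  msi⇒basic : ∀ {i j} → MSI u w C i j → Basic i j
  msi⇒basic (sk , minimal) with skipped⇒basic sk
  ... | i' , j' , b , i≤i' , j'≤j with refl , refl ← minimal i' j' (basic⇒skipped b) i≤i' j'≤j = b

  𝓙-msi : ∀ {Is} → MSIList u w C Is → 𝓙 Is ≡ map interval Is
  𝓙-msi {Is} (sound , _ , sorted) = subst (λ n → jseqF n (map interval Is) ≡ map interval Is)
    (length-map interval Is)
    (jseqF-separated (map interval Is) (All.map⁺ (All.map inhabited basics))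
      (AllPairs.map⁺ (disjoint basics (Linked⇒AllPairs <-trans sorted))))
    where
    basics : All (λ a → Basic (proj₁ a) (proj₂ a)) Is
    basics = All.tabulate λ a∈ → msi⇒basic (sound _ _ a∈)
    inhabited : ∀ {a} → Basic (proj₁ a) (proj₂ a) → Inhabited (interval a)
    inhabited b = _ , interval⁺ ≤-refl (basic-long b)
    disjoint : ∀ {Is} → All (λ a → Basic (proj₁ a) (proj₂ a)) Is →
      AllPairs (λ a b → proj₁ a < proj₁ b) Is → AllPairs (λ a b → Disjoint (interval a) (interval b)) Is
    disjoint [] [] = []
    disjoint {a ∷ _} (b ∷ bs) (lt ∷ lts) = All.map apart (All.zip (bs , lt)) ∷ disjoint bs lts
      where
      apart : ∀ {a₂} → Basic (proj₁ a₂) (proj₂ a₂) × proj₁ a < proj₁ a₂ →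
        Disjoint (interval a) (interval a₂)
      apart (b₂ , i<) k k∈ k∈₂ =
        let i<k , k<j = interval⁻ k∈ ; i₂<k , k<j₂ = interval⁻ k∈₂
        in <⇒≢ i< (proj₁ (basic-overlap b b₂ i<k k<j i₂<k k<j₂))

  tiles⇒msiList : ∀ {Is} → Tiles 0 Is → MSIList u w C Is
  tiles⇒msiList T = (λ i j a∈ → basic⇒msi (tiles-basic T a∈)) ,
    (λ i j m → tiles-complete T (msi⇒basic m)) , tiles-sorted T

  msiList-unique : ∀ {Is Js} → MSIList u w C Is → MSIList u w C Js → Is ≡ Js
  msiList-unique (s₁ , c₁ , o₁) (s₂ , c₂ , o₂) = sorted-unique
    (Linked⇒AllPairs <-trans o₁) (Linked⇒AllPairs <-trans o₂)
    (λ a∈ → c₂ _ _ (s₁ _ _ a∈)) (λ a∈ → c₁ _ _ (s₂ _ _ a∈))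

  critical⇒covered : Critical u w C → Covered
  critical⇒covered (Is , msis , cover) k k<
    with find (Any.map⁻ (subst (Any (suc k ∈_)) (𝓙-msi msis) (Equivalence.to (cover (suc k))
      (s≤s z≤n , subst (suc k <_) (sym (words-length w ls)) k<))))
  ... | (i , j) , a∈ , k∈ = let i<k , k<j = interval⁻ k∈ in
    i , j , msi⇒basic (proj₁ msis i j a∈) , i<k , k<j

  covered⇒critical : Covered → Critical u w C
  covered⇒critical cov = critical (1 ≤? length ls)
    where
    critical : Dec (1 ≤ length ls) → Critical u w C
    -- A chain without labels has no interior words and no skipped intervals.
    critical (no none) = [] ,
      ((λ _ _ ()) , (λ i j m → contradiction (≤-trans (s≤s z≤n)
        (≤-trans (basic-long (msi⇒basic m)) (basic-inside (msi⇒basic m)))) none) , []) ,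
      λ k → mk⇔ (λ { (1≤k , k<) → contradiction
        (≤-trans 1≤k (<⇒≤ (subst (k <_) (words-length w ls) k<))) none }) λ ()
    critical (yes 1≤d) with tiling cov 1≤d
    ... | Is , T = Is , tiles⇒msiList T , λ k → mk⇔
      (λ { (1≤k , k<) →
        let i , j , a∈ , i<k , k<j = tiles-cover T 1≤k (subst (k <_) (words-length w ls) k<)
        in subst (Any (k ∈_)) (sym (𝓙-msi (tiles⇒msiList T)))
             (Any.map⁺ (lose a∈ (interval⁺ i<k k<j))) })
      (λ k∈ → let (i , j) , a∈ , k∈' = find (Any.map⁻ (subst (Any (k ∈_)) (𝓙-msi (tiles⇒msiList T)) k∈))
                  i<k , k<j = interval⁻ k∈'
              in ≤-trans (s≤s z≤n) i<k , subst (k <_) (sym (words-length w ls))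
                   (<-≤-trans k<j (basic-inside (tiles-basic T a∈))))

  final : state w ls (length ls) ≡ run w ls
  final = state-run w ls

  covered⇒decreasing : Covered → WeaklyDecreasing ls
  covered⇒decreasing cov = adjacent⇒decreasing ls (covered⇒descending cov)

  covered⇒normalEmb : Covered → NormalEmb u w (run w ls)
  covered⇒normalEmb cov = subst (λ e → length e ≡ length w) final (state-length w ls (length ls)) , refl ,
    (λ i _ → subst (λ e → e ! i ≤ w ! i) final (antitone i z≤n ≤-refl)) ,
    (λ i i< → near i (normal i i<)) ,
    (λ i _ one one' → subst (λ e → e ! suc i ≢ 0) final
      (leftmost⇒kept desc (leftmost w ls v) i one one')) ,
    (λ i i< 2≤ first → run-start i 2≤ first (normal i i<))
    where
    e = run w ls
    desc : Descending
    desc = pairs⇒index (decreasing⇒pairs (covered⇒decreasing cov))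
    Shape : ℕ → Set
    Shape i = e ! i ≡ w ! i ⊎ suc (e ! i) ≡ w ! i ⊎
      (e ! i ≡ 0 × 2 ≤ w ! i × Σ ℕ λ i' → i ≡ suc i' × w ! i' ≡ w ! i)
    normal : ∀ i → i < length w → Shape i
    normal i i< = subst (λ e → e ! i ≡ w ! i ⊎ suc (e ! i) ≡ w ! i ⊎
      (e ! i ≡ 0 × 2 ≤ w ! i × Σ ℕ λ i' → i ≡ suc i' × w ! i' ≡ w ! i)) final
      (covered⇒normal desc cov (!-pos pos) i i<)
    near : ∀ i → Shape i → e ! i ≡ w ! i ⊎ suc (e ! i) ≡ w ! i ⊎ e ! i ≡ 0
    near i (inj₁ eq) = inj₁ eq
    near i (inj₂ (inj₁ eq)) = inj₂ (inj₁ eq)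
    near i (inj₂ (inj₂ (eq , _))) = inj₂ (inj₂ eq)
    run-start : ∀ i → 2 ≤ w ! i → i ≡ 0 ⊎ (Σ ℕ λ i' → i ≡ suc i' × w ! i' ≢ w ! i) → Shape i → e ! i ≢ 0
    run-start i 2≤ _ (inj₁ eq) gone = contradiction (subst (2 ≤_) (trans (sym eq) gone) 2≤) λ ()
    run-start i 2≤ _ (inj₂ (inj₁ eq)) gone =
      contradiction (subst (2 ≤_) (trans (sym eq) (cong suc gone)) 2≤) λ { (s≤s ()) }
    run-start i 2≤ (inj₁ refl) (inj₂ (inj₂ (_ , _ , _ , () , _))) gone
    run-start i 2≤ (inj₂ (i' , refl , ≢)) (inj₂ (inj₂ (_ , _ , _ , refl , eq))) gone = ≢ eq

  normalEmb⇒covered : WeaklyDecreasing ls → NormalEmb u w (run w ls) → Covered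
  normalEmb⇒covered wd (len≡ , _ , _ , near , _ , run-start) = normal⇒covered
    (pairs⇒index (decreasing⇒pairs wd)) normal
    where
    e = run w ls
    Shape : ℕ → List ℕ → Set
    Shape i e = e ! i ≡ w ! i ⊎ suc (e ! i) ≡ w ! i ⊎
      (e ! i ≡ 0 × 2 ≤ w ! i × Σ ℕ λ i' → i ≡ suc i' × w ! i' ≡ w ! i)
    erased : ∀ i → i < length w → e ! i ≡ 0 → Shape i e
    erased i i< gone = by-letter (w ! i) refl
      where
      same-left : ∀ i → i < length w → e ! i ≡ 0 → 2 ≤ w ! i → Σ ℕ λ i' → i ≡ suc i' × w ! i' ≡ w ! i
      same-left zero i< gone 2≤ = contradiction gone (run-start 0 i< 2≤ (inj₁ refl))
      same-left (suc i) i< gone 2≤ with w ! i ≟ w ! suc i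
      ... | yes eq = i , refl , eq
      ... | no ≢ = contradiction gone (run-start (suc i) i< 2≤ (inj₂ (i , refl , ≢)))
      by-letter : ∀ a → w ! i ≡ a → Shape i e
      by-letter zero eq = inj₁ (trans gone (sym eq))
      -- An erased 1 counts as lowered by one, so no condition on its left neighbour arises.
      by-letter (suc zero) eq = inj₂ (inj₁ (trans (cong suc gone) (sym eq)))
      by-letter (suc (suc a)) eq = inj₂ (inj₂ (gone , 2≤ , same-left i i< gone 2≤))
        where
        2≤ : 2 ≤ w ! i
        2≤ = subst (2 ≤_) (sym eq) (s≤s (s≤s z≤n))
    inside : ∀ i → i < length w → Shape i e
    inside i i< with near i i<
    ... | inj₁ eq = inj₁ eq
    ... | inj₂ (inj₁ eq) = inj₂ (inj₁ eq)
    ... | inj₂ (inj₂ gone) = erased i i< gone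
    normal : ∀ i → NormalAt i
    normal i = subst (Shape i) (sym final) (at (i <? length w))
      where
      at : Dec (i < length w) → Shape i e
      at (yes i<) = inside i i<
      at (no i≮) = inj₁ (trans (!-beyond e (subst (_≤ i) (sym len≡) (≮⇒≥ i≮))) (sym (!-beyond w (≮⇒≥ i≮))))
        where
        !-beyond : ∀ x {i} → length x ≤ i → x ! i ≡ 0
        !-beyond [] _ = refl
        !-beyond (a ∷ x) (s≤s ≤i) = !-beyond x ≤i

  -- Sorted lists of minimal skipped intervals are unique, so the given one is the tiling; the added
  -- 1 accounts for the last label.
  msi-count : WeaklyDecreasing ls → Covered → 1 ≤ length ls → ∀ {Is} → MSIList u w C Is →
    length Is + 1 ≡ cost (length w) (w !_) (run w ls !_)
  msi-count wd cov 1≤d msis with tiling cov 1≤d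
  ... | Js , T with refl ← msiList-unique msis (tiles⇒msiList T) = trans (+-comm (length Js) 1)
    (trans (sym (tiles-count (pairs⇒index (decreasing⇒pairs wd)) (!-bound w) 1≤d T))
      (cong (λ e → cost (length w) (w !_) (e !_)) final))

-- Normal embeddings and critical chains.

-- A letter following a 1 is never erased: if it is a 1, by the condition on runs of 1's; if it is
-- larger, because it opens its run. This is what `descending⇒leftmost` asks for.
canonical-valid : ∀ {u w η} → Pos w → NormalEmb u w η → Valid w (canonical w η)
canonical-valid {u} {w} {η} pos (len≡ , _ , below , _ , ones , run-start) =
  weak⇒valid w ls wk (descending⇒leftmost (pairs⇒index (canonical-descending w η))
    (!-pos pos) (!-bound w) kept)
  where
  ls = canonical w η
  wk = canonical-weak w η
  open ChainWalk w ls wk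
  η-kept : ∀ q → suc q < length w → w ! q ≡ 1 → η ! suc q ≢ 0
  η-kept q q< one with w ! suc q ≟ 1
  ... | yes one' = ones q q< one one'
  ... | no ≢1 = run-start (suc q) q< (≤∧≢⇒< (!-pos pos (suc q) q<) (≢1 ∘ sym))
    (inj₂ (q , refl , λ eq → ≢1 (trans (sym eq) one)))
  kept : ∀ q → suc q < length w → w ! q ≡ 1 → state w ls (length ls) ! suc q ≢ 0
  kept q q< one = subst (λ e → e ! suc q ≢ 0)
    (sym (trans (state-run w ls) (canonical-run w η len≡ below))) (η-kept q q< one)

theorem4p4 : (u w : Word) → Pos u → Pos w → u ≼ w →
    ((η : List ℕ) → NormalEmb u w η →
    Σ (List Word) λ C → WDChain u w C η ×
    ((C' : List Word) → WDChain u w C' η → C' ≡ C))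
    × ((η₁ η₂ : List ℕ) (C : List Word) → NormalEmb u w η₁ → NormalEmb u w η₂ →
    WDChain u w C η₁ → WDChain u w C η₂ → η₁ ≡ η₂)
    × ((η : List ℕ) (C : List Word) → NormalEmb u w η → WDChain u w C η →
    Critical u w C)
    × ((C : List Word) → MaxChain u w C → Critical u w C →
    Σ (List ℕ) λ η → NormalEmb u w η × WDChain u w C η)
    × ((C : List Word) (ls η : List ℕ) (Is : List (ℕ × ℕ)) →
    u ≢ w → MaxChain u w C → Labeling C ls η → Critical u w C →
    MSIList u w C Is →
    SameCollection (map interval Is) (𝓙 Is) ×
    length Is + 1 ≡ defect η w + 2 * Defect0 η w)
theorem4p4 u w _ pos _ = exists , injective , critical , normal , counted
  where
  labels-of : ∀ {C ls η} → MaxChain u w C → Labeling C ls η →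
    Valid w ls × C ≡ w ∷ words w ls × u ≡ nz (run w ls) × η ≡ run w ls
  labels-of chain L with maxchain⇒labels pos chain
  ... | ls , v , refl , u≡ with Labelled.labeling-unique w pos ls v L
  ... | refl , η≡ = v , refl , u≡ , η≡

  exists : (η : List ℕ) → NormalEmb u w η → Σ (List Word) λ C → WDChain u w C η ×
    ((C' : List Word) → WDChain u w C' η → C' ≡ C)
  exists η normal@(len≡ , nz≡ , below , _) =
    w ∷ words w ls ,
    (subst (λ y → MaxChain y w (w ∷ words w ls)) (trans (cong nz run≡) nz≡) (Labelled.maximal w pos ls v) ,
     ls , subst (Labels w (words w ls) ls) run≡ (valid⇒labels w ls v) ,
     AllPairs⇒Linked (canonical-descending w η)) , unique
    where
    ls = canonical w η
    v = canonical-valid pos normal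
    run≡ = canonical-run w η len≡ below
    unique : (C' : List Word) → WDChain u w C' η → C' ≡ w ∷ words w ls
    unique C' (chain , ls' , L , wd) with labels-of chain L
    ... | v' , refl , _ , refl = cong (λ x → w ∷ words w x)
      (canonical-unique w ls' (decreasing⇒pairs wd) (valid⇒weak ls' v'))

  injective : (η₁ η₂ : List ℕ) (C : List Word) → NormalEmb u w η₁ → NormalEmb u w η₂ →
    WDChain u w C η₁ → WDChain u w C η₂ → η₁ ≡ η₂
  injective η₁ η₂ C _ _ (chain , ls₁ , L₁ , _) (_ , ls₂ , L₂ , _) with labels-of chain L₁
  ... | v , refl , _ , refl = sym (proj₂ (Labelled.labeling-unique w pos ls₁ v L₂))

  critical : (η : List ℕ) (C : List Word) → NormalEmb u w η → WDChain u w C η → Critical u w C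
  critical η C normal (chain , ls , L , wd) with labels-of chain L
  ... | v , refl , refl , refl = covered⇒critical (normalEmb⇒covered wd normal)
    where open Labelled w pos ls v

  normal : (C : List Word) → MaxChain u w C → Critical u w C →
    Σ (List ℕ) λ η → NormalEmb u w η × WDChain u w C η
  normal C chain crit with maxchain⇒labels pos chain
  ... | ls , v , refl , refl = run w ls , covered⇒normalEmb cov ,
    chain , ls , valid⇒labels w ls v , covered⇒decreasing cov
    where
    open Labelled w pos ls v
    cov = critical⇒covered crit

  counted : (C : List Word) (ls η : List ℕ) (Is : List (ℕ × ℕ)) →
    u ≢ w → MaxChain u w C → Labeling C ls η → Critical u w C → MSIList u w C Is →
    SameCollection (map interval Is) (𝓙 Is) × length Is + 1 ≡ defect η w + 2 * Defect0 η w
  counted C ls η Is u≢w chain L crit msis with labels-of chain L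
  ... | v , refl , refl , refl =
    subst (SameCollection (map interval Is)) (sym (𝓙-msi msis)) (same , same) ,
    trans (msi-count (covered⇒decreasing cov) cov (nonempty ls u≢w) msis)
      (let len≡ , _ , _ , near , _ = covered⇒normalEmb cov in cost-defects (run w ls) w len≡ near)
    where
    open Labelled w pos ls v using (𝓙-msi; msi-count; critical⇒covered; covered⇒decreasing; covered⇒normalEmb)
    cov = critical⇒covered crit
    same : All (λ A → Any (SameSet A) (map interval Is)) (map interval Is)
    same = All.tabulate λ A∈ → lose A∈ λ _ → mk⇔ id id
    nonempty : ∀ ls → nz (run w ls) ≢ w → 1 ≤ length ls
    -- Without labels the chain would end at `w` itself.
    nonempty [] ≢ = contradiction (nz-pos pos) ≢
    nonempty (_ ∷ _) _ = s≤s z≤n
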